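{- There exists an $O(n)$-space data structure for the Useful String Indexing problem with $O(m)$ query time. That is, given a string with utilities $(T,w)$ of length $n$ for preprocessing, there is a data structure of size $O(n)$ that, given any pattern $P$ of length $m$, returns the global utility of $P$ in $T$ in $O(m)$ time.
   Context: A string with utilities is a pair $(T,w)$ consisting of a string $T$ of length $n$ over an alphabet $\Sigma$ and a function $w$ mapping each $i \in \{1,\dots,n\}$ to a real number $w[i]$, the utility of $T[i]$. $\mathrm{Occ}_T(P)$ is the set of starting positions of occurrences of $P$ in $T$; patterns have length $m \le n$. The global utility of a pattern $P$ of length $m$ in $T$ is $\sum_{i \in \mathrm{Occ}_T(P)} \sum_{j=i}^{i+m-1} w[j]$. Space is measured in machine words in the standard word-RAM model; a real utility value occupies one word and two values can be added or subtracted in $O(1)$ time. -}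

module Defs where

open import Algebra.Bundles using (AbelianGroup)
open import Algebra.Properties.CommutativeSemigroup as CommutativeSemigroup using ()
open import Algebra.Properties.Group as Group using ()
open import Data.Bool.Base using (Bool; if_then_else_; _∧_; _∨_; _xor_)
open import Data.Fin.Base using (Fin; toℕ; inject≤)
open import Data.Fin.Properties as Fin using (all?; any?)
open import Data.List.Base using (List; []; _∷_; allFin; drop; filter; foldr; head; length; replicate)
open import Data.Maybe.Base using (Maybe; just; nothing; maybe′)
open import Data.Nat.Base as ℕ using (ℕ; zero; suc)
open import Data.Nat.DivMod using (_mod_)
import Data.Nat.Properties as ℕ
open import Data.Product.Base using (∃; _×_; _,_)
open import Data.Rational.Base as ℚ using (ℚ; 0ℚ; ½; ∣_∣)
import Data.Rational.Properties as ℚ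
open import Data.Vec.Base as Vec using (Vec; lookup; _[_]≔_)
open import Level using (0ℓ)
open import Relation.Binary.PropositionalEquality
  using (_≡_; refl; sym; trans; cong; subst; module ≡-Reasoning)
open import Relation.Nullary using (does)
open import Relation.Nullary.Decidable using (_×-dec_)
open import Relation.Unary using (Decidable)

------------------------------------------------------------------------
-- Real numbers: Cauchy sequences of rationals with a modulus of
-- convergence, compared by the setoid equality "the difference tends to 0".

record ℝ : Set where
  constructor mkℝ
  field
    seq    : ℕ → ℚ
    cauchy : ∀ ε → 0ℚ ℚ.< ε →
             ∃ λ N → ∀ i j → N ℕ.≤ i → N ℕ.≤ j → ∣ seq i ℚ.- seq j ∣ ℚ.< ε

open ℝ public

infix 4 _≈ᴿ_
_≈ᴿ_ : ℝ → ℝ → Set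
x ≈ᴿ y = ∀ ε → 0ℚ ℚ.< ε →
         ∃ λ N → ∀ i → N ℕ.≤ i → ∣ seq x i ℚ.- seq y i ∣ ℚ.< ε

private
  open CommutativeSemigroup (AbelianGroup.commutativeSemigroup ℚ.+-0-abelianGroup)
    using () renaming (interchange to +-interchange)
  open Group ℚ.+-0-group using (⁻¹-involutive)

  half-pos : ∀ ε → 0ℚ ℚ.< ε → 0ℚ ℚ.< ½ ℚ.* ε
  half-pos ε 0<ε =
    subst (ℚ._< ½ ℚ.* ε) (ℚ.*-zeroʳ ½) (ℚ.*-monoʳ-<-pos ½ 0<ε)

  halves : ∀ ε → ½ ℚ.* ε ℚ.+ ½ ℚ.* ε ≡ ε
  halves ε = trans (sym (ℚ.*-distribʳ-+ ε ½ ½)) (ℚ.*-identityˡ ε)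

  split-< : ∀ {ε} p q r → r ≡ p ℚ.+ q →
            ∣ p ∣ ℚ.< ½ ℚ.* ε → ∣ q ∣ ℚ.< ½ ℚ.* ε → ∣ r ∣ ℚ.< ε
  split-< {ε} p q _ refl p< q< = ℚ.≤-<-trans (ℚ.∣p+q∣≤∣p∣+∣q∣ p q)
    (subst (∣ p ∣ ℚ.+ ∣ q ∣ ℚ.<_) (halves ε) (ℚ.+-mono-< p< q<))

  interchange : ∀ a b c d → (a ℚ.+ b) ℚ.- (c ℚ.+ d) ≡ (a ℚ.- c) ℚ.+ (b ℚ.- d)
  interchange a b c d = trans (cong ((a ℚ.+ b) ℚ.+_) (ℚ.neg-distrib-+ c d))
    (+-interchange a b (ℚ.- c) (ℚ.- d))

  telescope : ∀ a b c → a ℚ.- c ≡ (a ℚ.- b) ℚ.+ (b ℚ.- c)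
  telescope a b c = sym (begin
    (a ℚ.- b) ℚ.+ (b ℚ.- c)             ≡⟨ ℚ.+-assoc a _ _ ⟩
    a ℚ.+ (ℚ.- b ℚ.+ (b ℚ.- c))         ≡⟨ cong (a ℚ.+_) (sym (ℚ.+-assoc (ℚ.- b) b (ℚ.- c))) ⟩
    a ℚ.+ ((ℚ.- b ℚ.+ b) ℚ.- c)         ≡⟨ cong (λ t → a ℚ.+ (t ℚ.- c)) (ℚ.+-inverseˡ b) ⟩
    a ℚ.+ (0ℚ ℚ.- c)                    ≡⟨ cong (a ℚ.+_) (ℚ.+-identityˡ _) ⟩
    a ℚ.- c                             ∎)
    where open ≡-Reasoning

  ∣neg-diff∣ : ∀ a b → ∣ ℚ.- a ℚ.- ℚ.- b ∣ ≡ ∣ a ℚ.- b ∣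
  ∣neg-diff∣ a b = trans (cong ∣_∣ (sym (ℚ.neg-distrib-+ a (ℚ.- b)))) (ℚ.∣-p∣≡∣p∣ _)

  ∣diff∣-comm : ∀ a b → ∣ a ℚ.- b ∣ ≡ ∣ b ℚ.- a ∣
  ∣diff∣-comm a b = trans (sym (∣neg-diff∣ a b))
    (cong ∣_∣ (trans (ℚ.+-comm (ℚ.- a) _) (cong (ℚ._+ ℚ.- a) (⁻¹-involutive b))))

0ᴿ : ℝ
0ᴿ = mkℝ (λ _ → 0ℚ) λ _ 0<ε → 0 , λ _ _ _ _ → 0<ε

infixl 6 _+ᴿ_
_+ᴿ_ : ℝ → ℝ → ℝ
seq (x +ᴿ y) i = seq x i ℚ.+ seq y i
cauchy (x +ᴿ y) ε 0<ε with cauchy x _ (half-pos ε 0<ε) | cauchy y _ (half-pos ε 0<ε)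
... | M , p | N , q = M ℕ.⊔ N , λ i j M⊔N≤i M⊔N≤j →
  split-< _ _ _ (interchange (seq x i) (seq y i) (seq x j) (seq y j))
    (p i j (ℕ.m⊔n≤o⇒m≤o M N M⊔N≤i) (ℕ.m⊔n≤o⇒m≤o M N M⊔N≤j))
    (q i j (ℕ.m⊔n≤o⇒n≤o M N M⊔N≤i) (ℕ.m⊔n≤o⇒n≤o M N M⊔N≤j))

-ᴿ_ : ℝ → ℝ
seq (-ᴿ x) i = ℚ.- seq x i
cauchy (-ᴿ x) ε 0<ε with cauchy x ε 0<ε
... | N , p = N , λ i j N≤i N≤j →
  subst (ℚ._< ε) (sym (∣neg-diff∣ (seq x i) (seq x j))) (p i j N≤i N≤j)

private
  pointwise : ∀ {x y} → (∀ i → seq x i ≡ seq y i) → x ≈ᴿ y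
  pointwise {x} {y} x≡y ε 0<ε = 0 , λ i _ → subst (λ p → ∣ p ∣ ℚ.< ε)
    (sym (trans (cong (ℚ._- seq y i) (x≡y i)) (ℚ.+-inverseʳ (seq y i)))) 0<ε

  ≈ᴿ-sym : ∀ {x y} → x ≈ᴿ y → y ≈ᴿ x
  ≈ᴿ-sym {x} {y} x≈y ε 0<ε with x≈y ε 0<ε
  ... | N , p = N , λ i N≤i → subst (ℚ._< ε) (∣diff∣-comm (seq x i) (seq y i)) (p i N≤i)

  ≈ᴿ-trans : ∀ {x y z} → x ≈ᴿ y → y ≈ᴿ z → x ≈ᴿ z
  ≈ᴿ-trans {x} {y} {z} x≈y y≈z ε 0<ε
    with x≈y _ (half-pos ε 0<ε) | y≈z _ (half-pos ε 0<ε)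
  ... | M , p | N , q = M ℕ.⊔ N , λ i M⊔N≤i →
    split-< _ _ _ (telescope (seq x i) (seq y i) (seq z i))
      (p i (ℕ.m⊔n≤o⇒m≤o M N M⊔N≤i)) (q i (ℕ.m⊔n≤o⇒n≤o M N M⊔N≤i))

  +ᴿ-cong : ∀ {x y u v} → x ≈ᴿ y → u ≈ᴿ v → x +ᴿ u ≈ᴿ y +ᴿ v
  +ᴿ-cong {x} {y} {u} {v} x≈y u≈v ε 0<ε
    with x≈y _ (half-pos ε 0<ε) | u≈v _ (half-pos ε 0<ε)
  ... | M , p | N , q = M ℕ.⊔ N , λ i M⊔N≤i →
    split-< _ _ _ (interchange (seq x i) (seq u i) (seq y i) (seq v i))
      (p i (ℕ.m⊔n≤o⇒m≤o M N M⊔N≤i)) (q i (ℕ.m⊔n≤o⇒n≤o M N M⊔N≤i))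

  -ᴿ-cong : ∀ {x y} → x ≈ᴿ y → -ᴿ x ≈ᴿ -ᴿ y
  -ᴿ-cong {x} {y} x≈y ε 0<ε with x≈y ε 0<ε
  ... | N , p = N , λ i N≤i →
    subst (ℚ._< ε) (sym (∣neg-diff∣ (seq x i) (seq y i))) (p i N≤i)

ℝ-+-abelianGroup : AbelianGroup 0ℓ 0ℓ
ℝ-+-abelianGroup = record
  { Carrier = ℝ
  ; _≈_     = _≈ᴿ_
  ; _∙_     = _+ᴿ_
  ; ε       = 0ᴿ
  ; _⁻¹     = -ᴿ_
  ; isAbelianGroup = record
    { isGroup = record
      { isMonoid = record
        { isSemigroup = record
          { isMagma = record
            { isEquivalence = record
              { refl  = λ {x} → pointwise {x} {x} λ _ → refl
              ; sym   = λ {x} {y} → ≈ᴿ-sym {x} {y}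
              ; trans = λ {x} {y} {z} → ≈ᴿ-trans {x} {y} {z}
              }
            ; ∙-cong = λ {x} {y} {u} {v} → +ᴿ-cong {x} {y} {u} {v}
            }
          ; assoc = λ x y z → pointwise {(x +ᴿ y) +ᴿ z} {x +ᴿ (y +ᴿ z)}
                              λ i → ℚ.+-assoc (seq x i) (seq y i) (seq z i)
          }
        ; identity = (λ x → pointwise {0ᴿ +ᴿ x} {x} λ i → ℚ.+-identityˡ (seq x i))
                   , (λ x → pointwise {x +ᴿ 0ᴿ} {x} λ i → ℚ.+-identityʳ (seq x i))
        }
      ; inverse = (λ x → pointwise { -ᴿ x +ᴿ x} {0ᴿ} λ i → ℚ.+-inverseˡ (seq x i))
                , (λ x → pointwise {x +ᴿ -ᴿ x} {0ᴿ} λ i → ℚ.+-inverseʳ (seq x i))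
      ; ⁻¹-cong = λ {x} {y} → -ᴿ-cong {x} {y}
      }
    ; comm = λ x y → pointwise {x +ᴿ y} {y +ᴿ x} λ i → ℚ.+-comm (seq x i) (seq y i)
    }
  }

------------------------------------------------------------------------
-- Strings and occurrences. Positions are 0-based, and a string over an
-- alphabet with σ letters is a vector over Fin σ.

OccursAt : ∀ {σ n m} → Vec (Fin σ) n → Vec (Fin σ) m → Fin n → Set
OccursAt {n = n} {m} T P i =
  ∀ (j : Fin m) → ∃ λ (k : Fin n) → toℕ k ≡ toℕ i ℕ.+ toℕ j × lookup T k ≡ lookup P j

occursAt? : ∀ {σ n m} (T : Vec (Fin σ) n) (P : Vec (Fin σ) m) → Decidable (OccursAt T P)
occursAt? T P i = all? λ j → any? λ k →
  (toℕ k ℕ.≟ toℕ i ℕ.+ toℕ j) ×-dec (lookup T k Fin.≟ lookup P j)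

Occ : ∀ {σ n m} → Vec (Fin σ) n → Vec (Fin σ) m → List (Fin n)
Occ {n = n} T P = filter (occursAt? T P) (allFin n)

-- The positions j with i ≤ j ≤ i + m - 1.
window : ∀ {n} → Fin n → ℕ → List (Fin n)
window {n} i m =
  filter (λ j → (toℕ i ℕ.≤? toℕ j) ×-dec (toℕ j ℕ.<? toℕ i ℕ.+ m)) (allFin n)

------------------------------------------------------------------------

Word : ℕ → Set
Word W = Fin (2 ℕ.^ W)

wrap : ∀ W → ℕ → Word W
wrap W k = (k mod (2 ℕ.^ W)) {{ℕ.m^n≢0 2 W}}

bitwise : (Bool → Bool → Bool) → ℕ → ℕ → ℕ → ℕ
bitwise f zero    x y = 0
bitwise f (suc W) x y =
  (if f (odd x) (odd y) then 1 else 0) ℕ.+ 2 ℕ.* bitwise f W (x ℕ./ 2) (y ℕ./ 2)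
  where
  odd : ℕ → Bool
  odd z = does (z ℕ.% 2 ℕ.≟ 1)

data ArithOp : Set where
  add sub mul div mod shl shr and or xor : ArithOp

-- Division by zero is undefined (`nothing`); a shift count is a word.
evalArith : ∀ W → ArithOp → Word W → Word W → Maybe (Word W)
evalArith W op a b = apply op (toℕ a) (toℕ b)
  where
  apply : ArithOp → ℕ → ℕ → Maybe (Word W)
  apply add x y       = just (wrap W (x ℕ.+ y))
  apply sub x y       = just (wrap W (x ℕ.+ (2 ℕ.^ W ℕ.∸ y)))
  apply mul x y       = just (wrap W (x ℕ.* y))
  apply div x zero    = nothing
  apply div x (suc y) = just (wrap W (x ℕ./ suc y))
  apply mod x zero    = nothing
  apply mod x (suc y) = just (wrap W (x ℕ.% suc y))
  apply shl x y       = just (wrap W (x ℕ.* 2 ℕ.^ y))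
  apply shr x y       = just (wrap W ((x ℕ./ 2 ℕ.^ y) {{ℕ.m^n≢0 2 y}}))
  apply and x y       = just (wrap W (bitwise _∧_ W x y))
  apply or  x y       = just (wrap W (bitwise _∨_ W x y))
  apply xor x y       = just (wrap W (bitwise _xor_ W x y))

data Test : Set where
  eq lt : Test

evalTest : ∀ W → Test → Word W → Word W → Bool
evalTest W eq a b = does (toℕ a ℕ.≟ toℕ b)
evalTest W lt a b = does (toℕ a ℕ.<? toℕ b)

encode : ∀ W {σ m} → σ ℕ.≤ 2 ℕ.^ W → Vec (Fin σ) m → List (Word W)
encode W σ≤2^W P = Vec.toList (Vec.map (λ a → inject≤ a σ≤2^W) P)

read : ∀ {A : Set} → List A → ℕ → Maybe A
read xs i = head (drop i xs)

-- Overwriting outside the list is undefined.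
write : ∀ {A : Set} → List A → ℕ → A → Maybe (List A)
write []       _       _ = nothing
write (x ∷ xs) zero    y = just (y ∷ xs)
write (x ∷ xs) (suc i) y = maybe′ (λ ys → just (x ∷ ys)) nothing (write xs i y)

------------------------------------------------------------------------
-- Utilities are kept abstract up to addition and subtraction, the only
-- operations on them which the machine offers.

module Utilities (V : AbelianGroup 0ℓ 0ℓ) where

  open AbelianGroup V using (_∙_; _⁻¹; ε) renaming (Carrier to Value)

  sumOver : ∀ {A : Set} → List A → (A → Value) → Value
  sumOver xs f = foldr (λ x s → f x ∙ s) ε xs

  globalUtility : ∀ {σ n m} → Vec (Fin σ) n → (Fin n → Value) → Vec (Fin σ) m → Value
  globalUtility {m = m} T w P = sumOver (Occ T P) λ i → sumOver (window i m) w

  -- A word-RAM with k word registers and l utility registers. All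
  -- instructions have unit cost. A utility occupies one cell; cells holding
  -- words and cells holding utilities have separate address spaces. The data
  -- structure and the pattern are read-only; `work` cells may be written.
  data Instr (k l : ℕ) : Set where
    const                  : (dst : Fin k) → ℕ → Instr k l
    move                   : (dst src : Fin k) → Instr k l
    arith                  : ArithOp → (dst src₁ src₂ : Fin k) → Instr k l
    patLength              : (dst : Fin k) → Instr k l
    loadPat                : (dst addr : Fin k) → Instr k l
    loadData loadWork      : (dst addr : Fin k) → Instr k l
    storeWork              : (addr src : Fin k) → Instr k l
    jump                   : (target : ℕ) → Instr k l
    jumpIf                 : Test → (src₁ src₂ : Fin k) (target : ℕ) → Instr k l
    moveᵛ                  : (dst src : Fin l) → Instr k l
    addᵛ subᵛ              : (dst src₁ src₂ : Fin l) → Instr k l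
    loadDataᵛ loadWorkᵛ    : (dst : Fin l) (addr : Fin k) → Instr k l
    storeWorkᵛ             : (addr : Fin k) (src : Fin l) → Instr k l
    return                 : (src : Fin l) → Instr k l

  -- The word length is not a parameter: one program serves all of them.
  record Program : Set where
    field
      #wordRegs  : ℕ
      #valueRegs : ℕ
      code       : List (Instr #wordRegs #valueRegs)

  record DataStructure (W : ℕ) : Set where
    field
      words      : List (Word W)
      values     : List Value
      #workWords  : ℕ
      #workValues : ℕ

    size : ℕ
    size = length words ℕ.+ length values ℕ.+ #workWords ℕ.+ #workValues

  record State (W k l : ℕ) : Set where
    constructor ⟨_,_,_,_,_⟩
    field
      pc         : ℕ
      regs       : Vec (Word W) k
      valueRegs  : Vec Value l
      workWords  : List (Word W)
      workValues : List Value

  data Outcome (W k l : ℕ) : Set where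
    continue : State W k l → Outcome W k l
    returned : Value → Outcome W k l
    crashed  : Outcome W k l

  module _ {W : ℕ} (prog : Program) (D : DataStructure W) (pattern′ : List (Word W)) where

    open Program prog renaming (#wordRegs to k; #valueRegs to l)
    open DataStructure D

    execute : Instr k l → State W k l → Outcome W k l
    execute instr ⟨ pc , r , v , ww , wv ⟩ = go instr
      where
      setReg : Fin k → Maybe (Word W) → Outcome W k l
      setReg d (just x) = continue ⟨ suc pc , r [ d ]≔ x , v , ww , wv ⟩
      setReg d nothing  = crashed

      setValue : Fin l → Maybe Value → Outcome W k l
      setValue d (just x) = continue ⟨ suc pc , r , v [ d ]≔ x , ww , wv ⟩
      setValue d nothing  = crashed

      setWorkWords : Maybe (List (Word W)) → Outcome W k l
      setWorkWords (just ww′) = continue ⟨ suc pc , r , v , ww′ , wv ⟩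
      setWorkWords nothing    = crashed

      setWorkValues : Maybe (List Value) → Outcome W k l
      setWorkValues (just wv′) = continue ⟨ suc pc , r , v , ww , wv′ ⟩
      setWorkValues nothing    = crashed

      goto : ℕ → Outcome W k l
      goto t = continue ⟨ t , r , v , ww , wv ⟩

      addr : Fin k → ℕ
      addr a = toℕ (lookup r a)

      go : Instr k l → Outcome W k l
      go (const d c)        = setReg d (just (wrap W c))
      go (move d s)         = setReg d (just (lookup r s))
      go (arith op d s t)   = setReg d (evalArith W op (lookup r s) (lookup r t))
      go (patLength d)      = setReg d (just (wrap W (length pattern′)))
      go (loadPat d a)      = setReg d (read pattern′ (addr a))
      go (loadData d a)     = setReg d (read words (addr a))
      go (loadWork d a)     = setReg d (read ww (addr a))
      go (storeWork a s)    = setWorkWords (write ww (addr a) (lookup r s))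
      go (jump t)           = goto t
      go (jumpIf q a b t)   = goto (if evalTest W q (lookup r a) (lookup r b) then t else suc pc)
      go (moveᵛ d s)        = setValue d (just (lookup v s))
      go (addᵛ d s t)       = setValue d (just (lookup v s ∙ lookup v t))
      go (subᵛ d s t)       = setValue d (just (lookup v s ∙ lookup v t ⁻¹))
      go (loadDataᵛ d a)    = setValue d (read values (addr a))
      go (loadWorkᵛ d a)    = setValue d (read wv (addr a))
      go (storeWorkᵛ a s)   = setWorkValues (write wv (addr a) (lookup v s))
      go (return s)         = returned (lookup v s)

    step : State W k l → Outcome W k l
    step s = maybe′ (λ instr → execute instr s) crashed (read code (State.pc s))

    run : ℕ → State W k l → Maybe Value
    run zero    s = nothing
    run (suc t) s with step s
    ... | continue s′ = run t s′
    ... | returned x  = just x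
    ... | crashed     = nothing

    initial : State W k l
    initial = ⟨ 0 , Vec.replicate k (wrap W 0) , Vec.replicate l ε
              , replicate #workWords (wrap W 0) , replicate #workValues ε ⟩

    -- `queryWithin t ≡ just x`: x is returned after at most t instructions.
    queryWithin : ℕ → Maybe Value
    queryWithin t = run t initial

open Utilities ℝ-+-abelianGroup public

{-# OPTIONS --safe #-}

-- Writing PS for the prefix sums of w, the utility of an occurrence of P at i is PS (i + m) - PS i.
-- The sum of PS i over all occurrences depends only on the set of their starting positions, and the
-- sum of PS (i + m) only on the set of their end positions. The former set is the set of leaves below
-- the locus of P in the suffix tree of T, the latter that below the locus of the reversed P in the
-- suffix tree of the reversed T. Both trees store these sums at their nodes, so that a query is two
-- descents and a subtraction; the pattern is compared with the text only once, at the end of the first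
-- descent. The alphabet may be as large as 2 ^ W, so children are found by two-level perfect hashing,
-- with the hash functions x ↦ (a x mod 2 ^ W) >> t for odd a: a pair of distinct letters collides for
-- at most 3 * 2 ^ t of the 2 ^ (W - 1) multipliers, so some multiplier causes few collisions.

module Submission where

open import Algebra.Bundles using (AbelianGroup)
import Algebra.Properties.AbelianGroup as AbelianGroupProperties
import Algebra.Properties.CommutativeSemigroup as CommutativeSemigroupProperties
open import Data.Bool.Base using (true; false; if_then_else_)
open import Data.Empty using (⊥-elim)
open import Data.Fin.Base using (Fin; toℕ; fromℕ<; inject≤)
open import Data.Fin.Patterns
open import Data.Fin.Properties
  using (injective⇒≤; fromℕ<-injective; toℕ<n; toℕ-fromℕ<; toℕ-injective; toℕ-inject≤)
open import Data.List.Base as List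
  using (List; []; _∷_; _++_; map; filter; length; upTo; applyUpTo; tabulate; allFin; deduplicate)
open import Data.List.Properties
  using (length-++; length-map; length-upTo; length-applyUpTo; map-tabulate; map-applyUpTo; ++-identityʳ;
         filter-≐; filter-none; filter-all; filter-notAll; filter-++)
open import Data.List.Membership.Propositional using (_∈_; find)
open import Data.List.Membership.Propositional.Properties
open import Data.List.Relation.Unary.All as All using (All; []; _∷_)
open import Data.List.Relation.Unary.All.Properties as All using (¬All⇒Any¬)
open import Data.List.Relation.Unary.AllPairs using ([]; _∷_)
open import Data.List.Relation.Unary.Any as Any using (Any; here; there)
open import Data.List.Relation.Unary.Unique.Propositional using (Unique)
import Data.List.Relation.Unary.Unique.Propositional.Properties as Unique
import Data.List.Relation.Unary.Unique.DecPropositional.Properties as UniqueDec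
open import Data.Maybe.Base using (Maybe; just; nothing; maybe′; fromMaybe)
open import Data.Maybe.Properties using (just-injective; ≡-dec)
open import Data.Nat.Base
open import Data.Nat.DivMod
open import Data.Nat.Divisibility
open import Data.Nat.Induction using (<-rec)
open import Data.Nat.ListAction using (sum)
open import Data.Nat.Properties
open import Data.Nat.Solver using (module +-*-Solver)
open import Data.List.Membership.DecPropositional _≟_ using (_∈?_)
open import Data.Product.Base using (∃; Σ-syntax; _×_; _,_; proj₁; proj₂)
open import Data.Sum.Base using (_⊎_; inj₁; inj₂; [_,_]′)
open import Data.Vec.Base as Vec using (Vec; []; _∷_; lookup; _[_]≔_; toList)
open import Data.Vec.Properties using (length-toList)
open import Defs
open import Function.Base using (_∘_; id)
open import Level using (0ℓ)
open import Relation.Binary.PropositionalEquality hiding (setoid)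
import Relation.Binary.Reasoning.Setoid as SetoidReasoning
open import Relation.Nullary using (¬_; Dec; yes; no; does; contradiction)
open import Relation.Nullary.Decidable using (dec-true; dec-false)
open import Relation.Unary using (Pred; Decidable)
open +-*-Solver using (solve; _:=_; _:+_; _:*_; con)

-- Multiply-shift hashing

-- One tree could not hold the end sums: patterns that end at different points of one edge share
-- their starting positions, but the sum of `PS (i + m)` varies with `m`. Read backwards, an
-- occurrence begins at its end position, so one stored sum per node suffices again. A failed
-- look-up need not be recognized where it happens. If `P` occurs, every letter looked up labels a
-- child and the descent is right; otherwise it may end anywhere, but no text position stored there
-- can pass the comparison. The second descent is entered only once `P`, and with it the reversed
-- `P`, is known to occur. There is no randomness, so suitable multipliers come from averaging over
-- all odd ones during preprocessing. Linear space rests on two amortizations: the few collisions in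
-- a top table pay for its second-level tables, and the drop of `2 * length S ∸ 1` from a node to
-- its children pays for its dictionary. All resulting bounds are linear with coefficients below
-- 1000, hence the constant of the theorem.

-- Induction by halving. For the difference of two letters, the exponent `s` decides how many
-- multipliers make them collide, since multiplication by an odd number preserves it.
odd-part : ∀ d → 0 < d → ∃ λ s → ∃ λ r → d ≡ 2 ^ s * suc (2 * r)
odd-part = <-rec _ λ d rec 0<d → helper d rec 0<d (d % 2) refl (m≡m%n+[m/n]*n d 2)
  where
  helper : ∀ d → (∀ {e} → e < d → 0 < e → ∃ λ s → ∃ λ r → e ≡ 2 ^ s * suc (2 * r)) → 0 < d →
           ∀ p → p ≡ d % 2 → d ≡ d % 2 + d / 2 * 2 → ∃ λ s → ∃ λ r → d ≡ 2 ^ s * suc (2 * r)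
  helper d rec 0<d 0 eqn d≡ with d / 2
  ... | zero = contradiction (trans d≡ (cong (_+ 0) (sym eqn))) (m<n⇒n≢0 0<d)
  ... | e@(suc _) with rec {e} (subst (e <_) (sym d≡e2) (m<m*n e 2 ≤-refl)) z<s
    where d≡e2 = trans d≡ (cong (_+ e * 2) (sym eqn))
  ... | s , r , e≡ = suc s , r , (begin
    d                             ≡⟨ d≡ ⟩
    d % 2 + e * 2                 ≡⟨ cong₂ (λ p q → p + q * 2) (sym eqn) e≡ ⟩
    2 ^ s * suc (2 * r) * 2       ≡⟨ *-comm (2 ^ s * suc (2 * r)) 2 ⟩
    2 * (2 ^ s * suc (2 * r))     ≡⟨ sym (*-assoc 2 (2 ^ s) _) ⟩
    2 ^ suc s * suc (2 * r)       ∎)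
    where open ≡-Reasoning
  helper d rec 0<d 1 eqn d≡ = 0 , d / 2 ,
    trans d≡ (trans (cong₂ _+_ (sym eqn) (*-comm (d / 2) 2)) (sym (*-identityˡ _)))
  helper d rec 0<d (suc (suc p)) eqn d≡ =
    contradiction (subst (_< 2) (sym eqn) (m%n<n d 2)) λ { (s≤s (s≤s ())) }

2∤odd : ∀ r → ¬ 2 ∣ suc (2 * r)
2∤odd r 2∣ with ∣m+n∣m⇒∣n (subst (2 ∣_) (sym (+-comm (2 * r) 1)) 2∣) (m∣m*n r)
... | 2∣1 = contradiction (∣⇒≤ 2∣1) λ { (s≤s ()) }

-- The product is `c` plus the even number `2 * (c * r)`, so `c` is even whenever the product is;
-- this factor 2 cancels and `j` decreases.
2^∣*odd : ∀ j c r → 2 ^ j ∣ c * suc (2 * r) → 2 ^ j ∣ c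
2^∣*odd zero    c r _ = 1∣ c
2^∣*odd (suc j) c r 2^∣ with 2∣c
  where
  2∣c : 2 ∣ c
  2∣c = ∣m+n∣m⇒∣n {m = 2 * (c * r)}
    (subst (2 ∣_) (solve 2 (λ c r → c :* (con 1 :+ con 2 :* r) := con 2 :* (c :* r) :+ c) refl c r)
      (∣-trans (m∣m*n (2 ^ j)) 2^∣))
    (m∣m*n (c * r))
... | divides-refl c′ = subst (2 ^ suc j ∣_) (*-comm 2 c′) (*-monoʳ-∣ 2
  (2^∣*odd j c′ r (*-cancelˡ-∣ 2 (subst (2 ^ suc j ∣_)
    (solve 2 (λ c r → c :* con 2 :* r := con 2 :* (c :* r)) refl c′ (suc (2 * r))) 2^∣))))

2^∣2^ : ∀ {s t} → s ≤ t → 2 ^ s ∣ 2 ^ t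
2^∣2^ {s} {t} s≤t = divides (2 ^ (t ∸ s))
  (trans (cong (2 ^_) (sym (m∸n+n≡m s≤t))) (^-distribˡ-+-* 2 (t ∸ s) s))

2^-cancel-≤ : ∀ {s t} → 2 ^ s ≤ 2 ^ t → s ≤ t
2^-cancel-≤ {s} {t} le = ≮⇒≥ λ t<s → <⇒≱ (^-monoʳ-< 2 (s≤s (s≤s z≤n)) t<s) le

-- A machine word x is hashed to the leading W - t bits of a x mod 2 ^ W.
hash : ℕ → ℕ → ℕ → ℕ → ℕ
hash W a t x = (((a * x) % 2 ^ W) {{m^n≢0 2 W}} / 2 ^ t) {{m^n≢0 2 t}}

hash-< : ∀ W l a x → l ≤ W → hash W a (W ∸ l) x < 2 ^ l
hash-< W l a x l≤W = m<n*o⇒m/o<n {n = 2 ^ l} (subst ((a * x) % 2 ^ W <_)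
  (trans (cong (2 ^_) (sym (m+[n∸m]≡n l≤W))) (^-distribˡ-+-* 2 l (W ∸ l)))
  (m%n<n (a * x) (2 ^ W)))
  where
  instance
    _ = m^n≢0 2 W
    _ = m^n≢0 2 (W ∸ l)

odd : ℕ → ℕ
odd b = suc (2 * b)

Collide : ℕ → ℕ → ℕ → ℕ → ℕ → Set
Collide W t x y b = hash W (odd b) t x ≡ hash W (odd b) t y

/-≡⇒< : ∀ m n d .{{_ : NonZero d}} → m / d ≡ n / d → m < n + d
/-≡⇒< m n d eqn = begin-strict
  m                   ≡⟨ m≡m%n+[m/n]*n m d ⟩
  m % d + m / d * d   <⟨ +-monoˡ-< (m / d * d) (m%n<n m d) ⟩
  d + m / d * d       ≡⟨ cong (λ q → d + q * d) eqn ⟩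
  d + n / d * d       ≤⟨ +-monoʳ-≤ d (m/n*n≤m n d) ⟩
  d + n               ≡⟨ +-comm d n ⟩
  n + d               ∎
  where open ≤-Reasoning

-- With x = y + δ, δ = 2 ^ s * odd r and a = odd b, a collision forces E b ≡ a δ + 2 ^ t mod M to lie
-- below 2 * 2 ^ t. If t < s, this is impossible. Otherwise E b is a multiple of 2 ^ s which
-- determines b modulo 2 ^ (W′ ∸ s), and the remaining s bits of b fit below it in `code b`.
module Collision (M : ℕ) .{{_ : NonZero M}} (W′ : ℕ) (M≡ : M ≡ 2 ^ suc W′) (t y δ : ℕ) where

  instance
    2^t-nonZero = m^n≢0 2 t

  -- Adding `2 ^ t` before subtracting keeps `E` exact in ℕ: under a collision `X b` and `Y b` are
  -- less than `2 ^ t` apart, so nothing is truncated.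
  X Y E : ℕ → ℕ
  X b = (odd b * (y + δ)) % M
  Y b = (odd b * y) % M
  E b = X b + 2 ^ t ∸ Y b

  Coll : ℕ → Set
  Coll b = X b / 2 ^ t ≡ Y b / 2 ^ t

  module _ {b : ℕ} (coll : Coll b) where

    Y<X+2^t : Y b < X b + 2 ^ t
    Y<X+2^t = /-≡⇒< (Y b) (X b) (2 ^ t) (sym coll)

    E<2*2^t : E b < 2 ^ t + 2 ^ t
    E<2*2^t = +-cancelʳ-< (Y b) (E b) (2 ^ t + 2 ^ t) (begin-strict
      E b + Y b               ≡⟨ m∸n+n≡m (<⇒≤ Y<X+2^t) ⟩
      X b + 2 ^ t             <⟨ +-monoˡ-< (2 ^ t) (/-≡⇒< (X b) (Y b) (2 ^ t) coll) ⟩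
      Y b + 2 ^ t + 2 ^ t     ≡⟨ solve 2 (λ y s → y :+ s :+ s := s :+ s :+ y) refl (Y b) (2 ^ t) ⟩
      2 ^ t + 2 ^ t + Y b     ∎)
      where open ≤-Reasoning

    -- A congruence modulo `M` without subtraction: the quotients of the two reductions are added
    -- back on opposite sides.
    E-≡ : ∃ λ p → ∃ λ q → E b + p * M ≡ 2 ^ t + (q * M + odd b * δ)
    E-≡ = p , q , +-cancelˡ-≡ (Y b) _ _ (begin
      Y b + (E b + p * M)                   ≡⟨ solve 3 (λ y e p → y :+ (e :+ p) := e :+ y :+ p) refl (Y b) (E b) (p * M) ⟩
      E b + Y b + p * M                     ≡⟨ cong (_+ p * M) (m∸n+n≡m (<⇒≤ Y<X+2^t)) ⟩
      X b + 2 ^ t + p * M                   ≡⟨ solve 3 (λ x s p → x :+ s :+ p := s :+ (x :+ p)) refl (X b) (2 ^ t) (p * M) ⟩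
      2 ^ t + (X b + p * M)                 ≡⟨ cong (2 ^ t +_) (sym (m≡m%n+[m/n]*n (odd b * (y + δ)) M)) ⟩
      2 ^ t + odd b * (y + δ)               ≡⟨ cong (2 ^ t +_) (*-distribˡ-+ (odd b) y δ) ⟩
      2 ^ t + (odd b * y + odd b * δ)       ≡⟨ cong (λ z → 2 ^ t + (z + odd b * δ)) (m≡m%n+[m/n]*n (odd b * y) M) ⟩
      2 ^ t + (Y b + q * M + odd b * δ)     ≡⟨ solve 4 (λ s y q d → s :+ (y :+ q :+ d) := y :+ (s :+ (q :+ d))) refl (2 ^ t) (Y b) (q * M) (odd b * δ) ⟩
      Y b + (2 ^ t + (q * M + odd b * δ))   ∎)
      where
      open ≡-Reasoning
      p = odd b * (y + δ) / M
      q = odd b * y / M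

  module _ (s r : ℕ) (δ≡ : δ ≡ 2 ^ s * odd r) (s≤W′ : s ≤ W′) where

    instance
      2^s-nonZero = m^n≢0 2 s
      2^[W′∸s]-nonZero = m^n≢0 2 (W′ ∸ s)

    2^s∣δ : 2 ^ s ∣ δ
    2^s∣δ = subst (2 ^ s ∣_) (sym δ≡) (m∣m*n (odd r))

    2^s∣M : 2 ^ s ∣ M
    2^s∣M = subst (2 ^ s ∣_) (sym M≡) (2^∣2^ (m≤n⇒m≤1+n s≤W′))

    -- Both `M` and `δ` vanish modulo `2 ^ s`, and `E b` is below `2 ^ s`, so `E b` is exactly
    -- `2 ^ t`. Then `M` divides `odd b * δ`; but `2 ^ suc s` divides `M`, while the 2-adic
    -- valuation of `odd b * δ` is only `s`.
    none : t < s → ∀ {b} → ¬ Coll b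
    none t<s {b} coll with E-≡ {b} coll
    ... | p , q , E≡ = 2∤odd (2 * b * r + b + r) (*-cancelˡ-∣ (2 ^ s)
          (subst₂ _∣_ (*-comm 2 (2 ^ s)) (begin
            odd b * δ                                ≡⟨ cong (odd b *_) δ≡ ⟩
            odd b * (2 ^ s * odd r)                  ≡⟨ solve 3 (λ b s r → (con 1 :+ con 2 :* b) :* (s :* (con 1 :+ con 2 :* r))
                                                          := s :* (con 1 :+ con 2 :* (con 2 :* b :* r :+ b :+ r))) refl b (2 ^ s) r ⟩
            2 ^ s * odd (2 * b * r + b + r)          ∎)
          (∣-trans (subst (2 ^ suc s ∣_) (sym M≡) (2^∣2^ (s≤s s≤W′))) M∣)))
      where
      open ≡-Reasoning
      2*2^t≤2^s : 2 ^ t + 2 ^ t ≤ 2 ^ s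
      2*2^t≤2^s = subst (_≤ 2 ^ s) (cong (2 ^ t +_) (+-identityʳ (2 ^ t))) (^-monoʳ-≤ 2 t<s)
      E≡2^t : E b ≡ 2 ^ t
      E≡2^t = begin
        E b                                       ≡⟨ sym (m<n⇒m%n≡m (<-≤-trans (E<2*2^t {b} coll) 2*2^t≤2^s)) ⟩
        E b % 2 ^ s                               ≡⟨ sym (%-remove-+ʳ (E b) (∣n⇒∣m*n p 2^s∣M)) ⟩
        (E b + p * M) % 2 ^ s                     ≡⟨ cong (_% 2 ^ s) E≡ ⟩
        (2 ^ t + (q * M + odd b * δ)) % 2 ^ s     ≡⟨ %-remove-+ʳ (2 ^ t) (∣m∣n⇒∣m+n (∣n⇒∣m*n q 2^s∣M) (∣n⇒∣m*n (odd b) 2^s∣δ)) ⟩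
        2 ^ t % 2 ^ s                             ≡⟨ m<n⇒m%n≡m (^-monoʳ-< 2 (s≤s (s≤s z≤n)) t<s) ⟩
        2 ^ t                                     ∎
      M∣ : M ∣ odd b * δ
      M∣ = ∣m+n∣m⇒∣n (subst (M ∣_) (+-cancelˡ-≡ (2 ^ t) _ _ (trans (cong (_+ p * M) (sym E≡2^t)) E≡)) (n∣m*n p)) (n∣m*n q)

    code : ℕ → ℕ
    code b = E b + b / 2 ^ (W′ ∸ s)

    module _ (s≤t : s ≤ t) where

      high<2^s : ∀ {b} → b < 2 ^ W′ → b / 2 ^ (W′ ∸ s) < 2 ^ s
      high<2^s {b} b< = m<n*o⇒m/o<n {n = 2 ^ s} (subst (b <_)
        (trans (cong (2 ^_) (sym (m+[n∸m]≡n s≤W′))) (^-distribˡ-+-* 2 s (W′ ∸ s))) b<)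

      -- Origin of the factor 3: two parts bound `E b`, and the third bounds the top `s` bits of
      -- `b`, which are below `2 ^ s` and so below `2 ^ t`.
      code-< : ∀ {b} → b < 2 ^ W′ → Coll b → code b < 3 * 2 ^ t
      code-< {b} b< coll = begin-strict
        E b + b / 2 ^ (W′ ∸ s)         <⟨ +-mono-< (E<2*2^t {b} coll) (<-≤-trans (high<2^s b<) (^-monoʳ-≤ 2 s≤t)) ⟩
        2 ^ t + 2 ^ t + 2 ^ t          ≡⟨ solve 1 (λ t → t :+ t :+ t := con 3 :* t) refl (2 ^ t) ⟩
        3 * 2 ^ t                      ∎
        where open ≤-Reasoning

      2^s∣E : ∀ {b} → Coll b → 2 ^ s ∣ E b
      2^s∣E {b} coll with E-≡ {b} coll
      ... | p , q , E≡ = ∣m+n∣m⇒∣n {m = p * M} (subst (2 ^ s ∣_) (trans (sym E≡) (+-comm (E b) (p * M)))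
        (∣m∣n⇒∣m+n (2^∣2^ s≤t) (∣m∣n⇒∣m+n (∣n⇒∣m*n q 2^s∣M) (∣n⇒∣m*n (odd b) 2^s∣δ)))) (∣n⇒∣m*n p 2^s∣M)

      code-% : ∀ {b} → b < 2 ^ W′ → Coll b → code b % 2 ^ s ≡ b / 2 ^ (W′ ∸ s)
      code-% {b} b< coll = trans (%-remove-+ˡ _ (2^s∣E {b} coll)) (m<n⇒m%n≡m (high<2^s b<))

      -- Equal values of `E` make `M` divide `2 * (c * δ)`. Cancelling 2, then `2 ^ s`, then the odd
      -- part of `δ` leaves the claim.
      low-∣ : ∀ b c → Coll b → Coll (b + c) →
              E b ≡ E (b + c) → 2 ^ (W′ ∸ s) ∣ c
      low-∣ b c coll coll′ E≡E′ with E-≡ {b} coll | E-≡ {b + c} coll′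
      ... | p , q , e | p′ , q′ , e′ = 2^∣*odd (W′ ∸ s) c r (*-cancelˡ-∣ (2 ^ s)
        (subst₂ _∣_ (sym (trans (sym (^-distribˡ-+-* 2 s (W′ ∸ s))) (cong (2 ^_) (m+[n∸m]≡n s≤W′))))
          (trans (cong (c *_) δ≡) (solve 3 (λ c s r → c :* (s :* r) := s :* (c :* r)) refl c (2 ^ s) (odd r)))
          (*-cancelˡ-∣ 2 (subst (_∣ 2 * (c * δ)) M≡ M∣))))
        where
        open ≡-Reasoning
        sum≡ : p′ * M + q * M ≡ (p * M + q′ * M) + 2 * (c * δ)
        sum≡ = +-cancelˡ-≡ (E b + (2 ^ t + odd b * δ)) _ _ (begin
          E b + (2 ^ t + odd b * δ) + (p′ * M + q * M)
            ≡⟨ solve 5 (λ e t a p q → e :+ (t :+ a) :+ (p :+ q) := e :+ p :+ (t :+ (q :+ a))) refl (E b) (2 ^ t) (odd b * δ) (p′ * M) (q * M) ⟩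
          (E b + p′ * M) + (2 ^ t + (q * M + odd b * δ))
            ≡⟨ cong₂ _+_ (trans (cong (_+ p′ * M) E≡E′) e′) (sym e) ⟩
          (2 ^ t + (q′ * M + odd (b + c) * δ)) + (E b + p * M)
            ≡⟨ solve 7 (λ e t b c d p q → (t :+ (q :+ (con 1 :+ con 2 :* (b :+ c)) :* d)) :+ (e :+ p)
                 := e :+ (t :+ (con 1 :+ con 2 :* b) :* d) :+ ((p :+ q) :+ con 2 :* (c :* d))) refl
                 (E b) (2 ^ t) b c δ (p * M) (q′ * M) ⟩
          E b + (2 ^ t + odd b * δ) + ((p * M + q′ * M) + 2 * (c * δ)) ∎)
        M∣ : M ∣ 2 * (c * δ)
        M∣ = ∣m+n∣m⇒∣n (subst (M ∣_) sum≡ (∣m∣n⇒∣m+n (n∣m*n p′) (n∣m*n q))) (∣m∣n⇒∣m+n (n∣m*n p) (n∣m*n q′))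

      -- Because `E` is a multiple of `2 ^ s`, the code modulo `2 ^ s` is the high part of `b`, so
      -- both summands can be recovered. Hence `c` is a multiple of `2 ^ (W′ ∸ s)` that leaves the
      -- quotient unchanged, which forces it to be 0.
      code-injective-+ : ∀ b c → b < 2 ^ W′ → b + c < 2 ^ W′ → Coll b →
                         Coll (b + c) → code b ≡ code (b + c) → c ≡ 0
      code-injective-+ b c b< b+c< coll coll′ eqn = help (low-∣ b c coll coll′ E≡)
        where
        high≡ : b / 2 ^ (W′ ∸ s) ≡ (b + c) / 2 ^ (W′ ∸ s)
        high≡ = trans (sym (code-% {b} b< coll)) (trans (cong (_% 2 ^ s) eqn) (code-% {b + c} b+c< coll′))
        E≡ : E b ≡ E (b + c)
        E≡ = +-cancelʳ-≡ _ (E b) (E (b + c)) (trans eqn (cong (E (b + c) +_) (sym high≡)))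
        help : 2 ^ (W′ ∸ s) ∣ c → c ≡ 0
        help ∣c@(divides k c≡) = trans c≡ (cong (_* 2 ^ (W′ ∸ s)) (k≡0))
          where
          k≡0 : k ≡ 0
          k≡0 = +-cancelˡ-≡ (b / 2 ^ (W′ ∸ s)) _ _ (begin
            b / 2 ^ (W′ ∸ s) + k                       ≡⟨ cong (b / 2 ^ (W′ ∸ s) +_) (sym (trans (cong (_/ 2 ^ (W′ ∸ s)) c≡) (m*n/n≡m k (2 ^ (W′ ∸ s))))) ⟩
            b / 2 ^ (W′ ∸ s) + c / 2 ^ (W′ ∸ s)        ≡⟨ sym (+-distrib-/-∣ʳ b ∣c) ⟩
            (b + c) / 2 ^ (W′ ∸ s)                     ≡⟨ sym high≡ ⟩
            b / 2 ^ (W′ ∸ s)                           ≡⟨ sym (+-identityʳ _) ⟩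
            b / 2 ^ (W′ ∸ s) + 0                       ∎)
            where open ≡-Reasoning

      code-injective-≤ : ∀ {b b′} → b ≤ b′ → b < 2 ^ W′ → b′ < 2 ^ W′ → Coll b → Coll b′ →
                         code b ≡ code b′ → b ≡ b′
      code-injective-≤ {b} {b′} b≤b′ = subst
        (λ b″ → b < 2 ^ W′ → b″ < 2 ^ W′ → Coll b → Coll b″ → code b ≡ code b″ → b ≡ b″)
        (m+[n∸m]≡n b≤b′)
        λ b< b′< coll coll′ eqn → sym (trans
          (cong (b +_) (code-injective-+ b (b′ ∸ b) b< b′< coll coll′ eqn)) (+-identityʳ b))

      code-injective : ∀ {b b′} → b < 2 ^ W′ → b′ < 2 ^ W′ → Coll b → Coll b′ →
                       code b ≡ code b′ → b ≡ b′
      code-injective b< b′< coll coll′ eqn =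
        [ (λ b≤b′ → code-injective-≤ b≤b′ b< b′< coll coll′ eqn)
        , (λ b′≤b → sym (code-injective-≤ b′≤b b′< b< coll′ coll (sym eqn)))
        ]′ (≤-total _ _)

-- Counting collisions

∑ : ∀ {A : Set} → List A → (A → ℕ) → ℕ
∑ xs f = sum (map f xs)

indicator : ∀ {P : Set} → Dec P → ℕ
indicator (yes _) = 1
indicator (no _)  = 0

module _ {A : Set} where

  ∑-+ : ∀ (xs : List A) f g → ∑ xs (λ x → f x + g x) ≡ ∑ xs f + ∑ xs g
  ∑-+ []       f g = refl
  ∑-+ (x ∷ xs) f g = trans (cong (f x + g x +_) (∑-+ xs f g))
    (solve 4 (λ a b c d → a :+ b :+ (c :+ d) := a :+ c :+ (b :+ d)) refl (f x) (g x) (∑ xs f) (∑ xs g))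

  ∑-*ˡ : ∀ (xs : List A) c f → ∑ xs (λ x → c * f x) ≡ c * ∑ xs f
  ∑-*ˡ []       c f = sym (*-zeroʳ c)
  ∑-*ˡ (x ∷ xs) c f = trans (cong (c * f x +_) (∑-*ˡ xs c f)) (sym (*-distribˡ-+ c (f x) (∑ xs f)))

  ∑-mono : ∀ (xs : List A) {f g} → (∀ {x} → x ∈ xs → f x ≤ g x) → ∑ xs f ≤ ∑ xs g
  ∑-mono []       f≤g = z≤n
  ∑-mono (x ∷ xs) f≤g = +-mono-≤ (f≤g (here refl)) (∑-mono xs (f≤g ∘ there))

  ∑-const : ∀ (xs : List A) c → ∑ xs (λ _ → c) ≡ length xs * c
  ∑-const []       c = refl
  ∑-const (x ∷ xs) c = cong (c +_) (∑-const xs c)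

  ∑-cong : ∀ (xs : List A) {f g} → (∀ x → f x ≡ g x) → ∑ xs f ≡ ∑ xs g
  ∑-cong []       f≡g = refl
  ∑-cong (x ∷ xs) f≡g = cong₂ _+_ (f≡g x) (∑-cong xs f≡g)

  ∈⇒≤∑ : ∀ {xs : List A} {x} f → x ∈ xs → f x ≤ ∑ xs f
  ∈⇒≤∑ {_ ∷ xs} f (here refl) = m≤m+n _ _
  ∈⇒≤∑ {y ∷ xs} f (there x∈)  = ≤-trans (∈⇒≤∑ f x∈) (m≤n+m _ (f y))

  minimum≤average : ∀ (x : A) xs f → ∃ λ y → y ∈ x ∷ xs × length (x ∷ xs) * f y ≤ ∑ (x ∷ xs) f
  minimum≤average x xs f = go x xs
    where
    open ≤-Reasoning
    go : ∀ x xs → ∃ λ y → y ∈ x ∷ xs × length (x ∷ xs) * f y ≤ ∑ (x ∷ xs) f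
    go x []        = x , here refl , ≤-refl
    go x (x′ ∷ xs) with go x′ xs
    ... | y , y∈ , le with ≤-total (f x) (f y)
    ... | inj₁ fx≤fy = x , here refl , +-monoʳ-≤ (f x) (≤-trans (*-monoʳ-≤ (length (x′ ∷ xs)) fx≤fy) le)
    ... | inj₂ fy≤fx = y , there y∈ , +-mono-≤ fy≤fx le

  count : ∀ {P : Pred A 0ℓ} → Decidable P → List A → ℕ
  count P? xs = length (filter P? xs)

  count-∷ : ∀ {P : Pred A 0ℓ} (P? : Decidable P) x xs →
            count P? (x ∷ xs) ≡ indicator (P? x) + count P? xs
  count-∷ P? x xs with P? x
  ... | yes _ = refl
  ... | no  _ = refl

  lookup-injective : ∀ {xs : List A} → Unique xs → ∀ i j → List.lookup xs i ≡ List.lookup xs j → i ≡ j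
  lookup-injective (px ∷ _)  Fin.zero    Fin.zero    eqn = refl
  lookup-injective (px ∷ _)  Fin.zero    (Fin.suc j) eqn = contradiction eqn (All.lookup px (∈-lookup j))
  lookup-injective (px ∷ _)  (Fin.suc i) Fin.zero    eqn = contradiction (sym eqn) (All.lookup px (∈-lookup i))
  lookup-injective (_ ∷ xs!) (Fin.suc i) (Fin.suc j) eqn = cong Fin.suc (lookup-injective xs! i j eqn)

  injective⇒length≤ : ∀ {xs : List A} {k} (f : A → ℕ) → Unique xs → (∀ {x} → x ∈ xs → f x < k) →
            (∀ {x y} → x ∈ xs → y ∈ xs → f x ≡ f y → x ≡ y) → length xs ≤ k
  injective⇒length≤ {xs} f xs! f< f-inj = injective⇒≤ {f = λ i → fromℕ< (f< (∈-lookup i))}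
    λ {i} {j} eqn → lookup-injective xs! i j
      (f-inj (∈-lookup i) (∈-lookup j) (fromℕ<-injective _ _ (f< (∈-lookup i)) (f< (∈-lookup j)) eqn))

-- Double counting. It exchanges multipliers with letters when collisions are averaged, and letters
-- with items when the children of a tree node are measured.
∑-count-comm : ∀ {A B : Set} {R : A → B → Set} (R? : ∀ x y → Dec (R x y)) xs ys →
               ∑ xs (λ x → count (R? x) ys) ≡ ∑ ys (λ y → count (λ x → R? x y) xs)
∑-count-comm R? [] ys = sym (trans (∑-const ys 0) (*-zeroʳ (length ys)))
∑-count-comm R? (x ∷ xs) ys = begin
  count (R? x) ys + ∑ xs (λ x → count (R? x) ys)
    ≡⟨ cong₂ _+_ (count-∑ ys) (∑-count-comm R? xs ys) ⟩
  ∑ ys (λ y → indicator (R? x y)) + ∑ ys (λ y → count (λ x → R? x y) xs)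
    ≡⟨ sym (∑-+ ys _ _) ⟩
  ∑ ys (λ y → indicator (R? x y) + count (λ x → R? x y) xs)
    ≡⟨ ∑-cong ys (λ y → sym (count-∷ (λ x → R? x y) x xs)) ⟩
  ∑ ys (λ y → count (λ x → R? x y) (x ∷ xs)) ∎
  where
  open ≡-Reasoning
  count-∑ : ∀ ys → count (R? x) ys ≡ ∑ ys (λ y → indicator (R? x y))
  count-∑ []       = refl
  count-∑ (y ∷ ys) = trans (count-∷ (R? x) y ys) (cong (indicator (R? x y) +_) (count-∑ ys))

-- This is `length xs` choose 2, by a recursion parallel to that of `collisions`.
pairs : ∀ {A : Set} → List A → ℕ
pairs []       = 0
pairs (x ∷ xs) = length xs + pairs xs

pairs-filter-∷ : ∀ {A : Set} {P : Pred A 0ℓ} (P? : Decidable P) x xs → pairs (filter P? (x ∷ xs)) ≡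
                 indicator (P? x) * length (filter P? xs) + pairs (filter P? xs)
pairs-filter-∷ P? x xs with P? x
... | yes _ = cong (_+ pairs (filter P? xs)) (sym (+-identityʳ _))
... | no  _ = refl

2*pairs≤ : ∀ {A : Set} (xs : List A) → 2 * pairs xs ≤ length xs * length xs
2*pairs≤ []       = z≤n
2*pairs≤ (x ∷ xs) = begin
  2 * (length xs + pairs xs)             ≡⟨ *-distribˡ-+ 2 (length xs) (pairs xs) ⟩
  2 * length xs + 2 * pairs xs           ≤⟨ +-monoʳ-≤ (2 * length xs) (2*pairs≤ xs) ⟩
  2 * length xs + length xs * length xs  ≤⟨ n≤1+n _ ⟩
  1 + (2 * length xs + length xs * length xs) ≡⟨ solve 1 (λ k → con 1 :+ (con 2 :* k :+ k :* k) := (con 1 :+ k) :* (con 1 :+ k)) refl (length xs) ⟩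
  suc (length xs) * suc (length xs)      ∎
  where open ≤-Reasoning

collisions : (ℕ → ℕ) → List ℕ → ℕ
collisions h []       = 0
collisions h (x ∷ xs) = count (λ y → h x ≟ h y) xs + collisions h xs

bucket : (ℕ → ℕ) → List ℕ → ℕ → List ℕ
bucket h K t = filter (λ x → h x ≟ t) K

∑-indicator≤ : ∀ a (f : ℕ → ℕ) {xs} → Unique xs → ∑ xs (λ t → indicator (a ≟ t) * f t) ≤ f a
∑-indicator≤ a f {[]}     _ = z≤n
∑-indicator≤ a f {t ∷ xs} (t∉ ∷ xs!) with a ≟ t
... | no  _    = ∑-indicator≤ a f xs!
... | yes refl = begin
  f a + 0 + ∑ xs (λ t → indicator (a ≟ t) * f t)  ≤⟨ +-monoʳ-≤ (f a + 0) (∑-mono xs {g = λ _ → 0} zeros) ⟩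
  f a + 0 + ∑ xs (λ _ → 0)                        ≡⟨ cong (f a + 0 +_) (trans (∑-const xs 0) (*-zeroʳ (length xs))) ⟩
  f a + 0 + 0                                     ≡⟨ trans (+-identityʳ _) (+-identityʳ _) ⟩
  f a                                             ∎
  where
  open ≤-Reasoning
  zeros : ∀ {t} → t ∈ xs → indicator (a ≟ t) * f t ≤ 0
  zeros {t} t∈ with a ≟ t
  ... | no  _    = z≤n
  ... | yes refl = contradiction refl (All.lookup t∉ t∈)

-- Prepending `x` changes only the bucket of `h x`, which gains as many pairs as `x` has collisions
-- with `K`. It is an inequality because `ts` may miss some hash values.
∑-pairs-bucket≤ : ∀ h K {ts} → Unique ts → ∑ ts (λ t → pairs (bucket h K t)) ≤ collisions h K
∑-pairs-bucket≤ h [] {ts} ts! = ≤-reflexive (trans (∑-const ts 0) (*-zeroʳ (length ts)))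
∑-pairs-bucket≤ h (x ∷ K) {ts} ts! = begin
  ∑ ts (λ t → pairs (bucket h (x ∷ K) t))
    ≡⟨ ∑-cong ts split ⟩
  ∑ ts (λ t → indicator (h x ≟ t) * length (bucket h K t) + pairs (bucket h K t))
    ≡⟨ ∑-+ ts _ _ ⟩
  ∑ ts (λ t → indicator (h x ≟ t) * length (bucket h K t)) + ∑ ts (λ t → pairs (bucket h K t))
    ≤⟨ +-mono-≤ (∑-indicator≤ (h x) (λ t → length (bucket h K t)) ts!) (∑-pairs-bucket≤ h K ts!) ⟩
  length (bucket h K (h x)) + collisions h K
    ≡⟨ cong (λ ys → length ys + collisions h K) (filter-≐ (λ y → h y ≟ h x) (λ y → h x ≟ h y) (sym , sym) K) ⟩
  collisions h (x ∷ K) ∎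
  where
  open ≤-Reasoning
  split : ∀ t → pairs (bucket h (x ∷ K) t) ≡ indicator (h x ≟ t) * length (bucket h K t) + pairs (bucket h K t)
  split t = pairs-filter-∷ (λ y → h y ≟ t) x K

count≡0⇒¬ : ∀ {A : Set} {P : Pred A 0ℓ} (P? : Decidable P) xs → count P? xs ≡ 0 → ∀ {x} → x ∈ xs → ¬ P x
count≡0⇒¬ P? xs eqn x∈ px with filter P? xs | ∈-filter⁺ P? x∈ px
... | _ ∷ _ | _ = contradiction eqn λ ()

collisions≡0⇒injective : ∀ h K → collisions h K ≡ 0 → ∀ {x y} → x ∈ K → y ∈ K → h x ≡ h y → x ≡ y
collisions≡0⇒injective h (z ∷ K) eqn (here refl) (here refl) _ = refl
collisions≡0⇒injective h (z ∷ K) eqn (here refl) (there y∈) hx≡hy =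
  contradiction hx≡hy (count≡0⇒¬ (λ y → h z ≟ h y) K (m+n≡0⇒m≡0 _ eqn) y∈)
collisions≡0⇒injective h (z ∷ K) eqn (there x∈) (here refl) hx≡hy =
  contradiction (sym hx≡hy) (count≡0⇒¬ (λ y → h z ≟ h y) K (m+n≡0⇒m≡0 _ eqn) x∈)
collisions≡0⇒injective h (z ∷ K) eqn (there x∈) (there y∈) hx≡hy =
  collisions≡0⇒injective h K (m+n≡0⇒n≡0 _ eqn) x∈ y∈ hx≡hy

-- Universality of the hash family

module Universal (W′ : ℕ) where

  W = suc W′

  collide? : ∀ t x y b → Dec (Collide W t x y b)
  collide? t x y b = hash W (odd b) t x ≟ hash W (odd b) t y

  module _ (t y δ s r : ℕ) (δ≡ : δ ≡ 2 ^ s * odd r) (y+δ< : y + δ < 2 ^ W) where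

    open Collision (2 ^ W) {{m^n≢0 2 W}} W′ refl t y δ

    s≤W′ : s ≤ W′
    s≤W′ = s≤s⁻¹ (≰⇒> λ W≤s → <⇒≱ y+δ< (begin
      2 ^ W              ≤⟨ ^-monoʳ-≤ 2 W≤s ⟩
      2 ^ s              ≤⟨ m≤m*n (2 ^ s) (odd r) ⟩
      2 ^ s * odd r      ≡⟨ sym δ≡ ⟩
      δ                  ≤⟨ m≤n+m δ y ⟩
      y + δ              ∎))
      where open ≤-Reasoning

    colliding = filter (collide? t (y + δ) y) (upTo (2 ^ W′))

    ∈-colliding⁻ : ∀ {b} → b ∈ colliding → b < 2 ^ W′ × Coll b
    ∈-colliding⁻ b∈ with ∈-filter⁻ (collide? t (y + δ) y) {xs = upTo (2 ^ W′)} b∈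
    ... | b∈′ , coll = ∈-upTo⁻ b∈′ , coll

    length-colliding≤ : length colliding ≤ 3 * 2 ^ t
    length-colliding≤ with s ≤? t
    ... | yes s≤t = injective⇒length≤ (code s r δ≡ s≤W′) (Unique.filter⁺ (collide? t (y + δ) y) (Unique.upTo⁺ (2 ^ W′)))
      (λ b∈ → code-< s r δ≡ s≤W′ s≤t (proj₁ (∈-colliding⁻ b∈)) (proj₂ (∈-colliding⁻ b∈)))
      (λ b∈ b′∈ → code-injective s r δ≡ s≤W′ s≤t (proj₁ (∈-colliding⁻ b∈)) (proj₁ (∈-colliding⁻ b′∈))
                    (proj₂ (∈-colliding⁻ b∈)) (proj₂ (∈-colliding⁻ b′∈)))
    ... | no s≰t = subst (_≤ 3 * 2 ^ t) (sym (cong length (filter-none (collide? t (y + δ) y) {xs = upTo (2 ^ W′)}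
      (All.tabulate λ {b} _ → none s r δ≡ s≤W′ (≰⇒> s≰t) {b})))) z≤n

  count-collide≤ : ∀ t {x y} → x ≢ y → x < 2 ^ W → y < 2 ^ W →
                   count (collide? t x y) (upTo (2 ^ W′)) ≤ 3 * 2 ^ t
  count-collide≤ t {x} {y} x≢y x< y< with ≤-total y x
  ... | inj₁ y≤x = subst (λ z → z < 2 ^ W → count (collide? t z y) (upTo (2 ^ W′)) ≤ 3 * 2 ^ t) (m+[n∸m]≡n y≤x)
    (λ z< → let s , r , δ≡ = odd-part (x ∸ y) (m<n⇒0<n∸m (≤∧≢⇒< y≤x (x≢y ∘ sym))) in
      length-colliding≤ t y (x ∸ y) s r δ≡ z<) x<
  ... | inj₂ x≤y = subst (_≤ 3 * 2 ^ t) (cong length (filter-≐ (collide? t y x) (collide? t x y) (sym , sym) (upTo (2 ^ W′))))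
    (subst (λ z → z < 2 ^ W → count (collide? t z x) (upTo (2 ^ W′)) ≤ 3 * 2 ^ t) (m+[n∸m]≡n x≤y)
    (λ z< → let s , r , δ≡ = odd-part (y ∸ x) (m<n⇒0<n∸m (≤∧≢⇒< x≤y x≢y)) in
      length-colliding≤ t x (y ∸ x) s r δ≡ z<) y<)

  ∑-collisions≤ : ∀ t {K} → Unique K → All (_< 2 ^ W) K →
                  ∑ (upTo (2 ^ W′)) (λ b → collisions (hash W (odd b) t) K) ≤ pairs K * (3 * 2 ^ t)
  ∑-collisions≤ t {[]} _ _ = ≤-reflexive (trans (∑-const (upTo (2 ^ W′)) 0) (*-zeroʳ (length (upTo (2 ^ W′)))))
  ∑-collisions≤ t {x ∷ K} (x∉ ∷ K!) (x< ∷ K<) = begin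
    ∑ bs (λ b → count (λ y → collide? t x y b) K + collisions (hash W (odd b) t) K)
      ≡⟨ ∑-+ bs _ _ ⟩
    ∑ bs (λ b → count (λ y → collide? t x y b) K) + ∑ bs (λ b → collisions (hash W (odd b) t) K)
      ≤⟨ +-mono-≤ (≤-reflexive (∑-count-comm (λ b y → collide? t x y b) bs K)) (∑-collisions≤ t K! K<) ⟩
    ∑ K (λ y → count (collide? t x y) bs) + pairs K * (3 * 2 ^ t)
      ≤⟨ +-monoˡ-≤ _ (∑-mono K λ y∈ → count-collide≤ t (All.lookup x∉ y∈) x< (All.lookup K< y∈)) ⟩
    ∑ K (λ _ → 3 * 2 ^ t) + pairs K * (3 * 2 ^ t)
      ≡⟨ cong (_+ pairs K * (3 * 2 ^ t)) (∑-const K _) ⟩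
    length K * (3 * 2 ^ t) + pairs K * (3 * 2 ^ t)
      ≡⟨ sym (*-distribʳ-+ (3 * 2 ^ t) (length K) (pairs K)) ⟩
    pairs (x ∷ K) * (3 * 2 ^ t) ∎
    where
    open ≤-Reasoning
    bs = upTo (2 ^ W′)

  -- Some odd multiplier does no worse than the average over all of them. The 6 is the 3 of a single
  -- pair doubled, since only half of the `2 ^ W` words are odd.
  few-collisions : ∀ {K} l → l ≤ W → Unique K → All (_< 2 ^ W) K →
                   ∃ λ a → collisions (hash W a (W ∸ l)) K * 2 ^ l ≤ 6 * pairs K
  few-collisions {K} l l≤W K! K< with upTo (2 ^ W′) in eqn
  ... | []     = contradiction (trans (sym (length-upTo (2 ^ W′))) (cong length eqn)) (m^n≢0′ W′)
    where
    m^n≢0′ : ∀ n → 2 ^ n ≢ 0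
    m^n≢0′ n = m<n⇒n≢0 (m^n>0 2 n)
  ... | b₀ ∷ bs with minimum≤average b₀ bs (λ b → collisions (hash W (odd b) (W ∸ l)) K)
  ... | b , _ , le = odd b , *-cancelʳ-≤ (C * 2 ^ l) (6 * pairs K) (2 ^ (W ∸ l)) {{m^n≢0 2 (W ∸ l)}} (begin
      C * 2 ^ l * 2 ^ (W ∸ l)                    ≡⟨ *-assoc C (2 ^ l) _ ⟩
      C * (2 ^ l * 2 ^ (W ∸ l))                  ≡⟨ cong (C *_) (trans (sym (^-distribˡ-+-* 2 l (W ∸ l))) (cong (2 ^_) (m+[n∸m]≡n l≤W))) ⟩
      C * (2 * 2 ^ W′)                           ≡⟨ solve 2 (λ c n → c :* (con 2 :* n) := con 2 :* (n :* c)) refl C (2 ^ W′) ⟩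
      2 * (2 ^ W′ * C)                           ≡⟨ cong (λ n → 2 * (n * C)) (trans (sym (length-upTo (2 ^ W′))) (cong length eqn)) ⟩
      2 * (length (b₀ ∷ bs) * C)                 ≤⟨ *-monoʳ-≤ 2 le ⟩
      2 * ∑ (b₀ ∷ bs) (λ b → collisions (hash W (odd b) (W ∸ l)) K)   ≡⟨ cong (λ ys → 2 * ∑ ys (λ b → collisions (hash W (odd b) (W ∸ l)) K)) (sym eqn) ⟩
      2 * ∑ (upTo (2 ^ W′)) (λ b → collisions (hash W (odd b) (W ∸ l)) K)   ≤⟨ *-monoʳ-≤ 2 (∑-collisions≤ (W ∸ l) K! K<) ⟩
      2 * (pairs K * (3 * 2 ^ (W ∸ l)))          ≡⟨ solve 2 (λ p h → con 2 :* (p :* (con 3 :* h)) := con 6 :* p :* h) refl (pairs K) (2 ^ (W ∸ l)) ⟩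
      6 * pairs K * 2 ^ (W ∸ l)                  ∎)
    where
    open ≤-Reasoning
    C = collisions (hash W (odd b) (W ∸ l)) K

-- Tables have a power of two of slots. Rounding up loses a factor 2, which turns the thresholds
-- `6 * pairs K` and `length K` into table sizes up to `1 + 12 * pairs K` and `1 + 2 * length K`.
power-above : ∀ N → ∃ λ l → N < 2 ^ l × 2 ^ l ≤ suc (2 * N)
power-above zero    = 0 , s≤s z≤n , ≤-refl
power-above (suc N) with power-above N
... | l , N< , ≤N with suc N <? 2 ^ l
... | yes sN< = l , sN< , ≤-trans ≤N (s≤s (*-monoʳ-≤ 2 (n≤1+n N)))
... | no  sN≮ = suc l , subst (_≤ 2 ^ suc l) (+-comm (suc N) 1) (≤-trans (+-mono-≤ N< (m^n>0 2 l)) (≤-reflexive (cong (2 ^ l +_) (sym (+-identityʳ (2 ^ l))))))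
    , ≤-trans (*-monoʳ-≤ 2 (≮⇒≥ sN≮)) (n≤1+n _)

-- With more than `6 * pairs K` slots, the guaranteed number of collisions is below one, hence zero.
injective-hash : ∀ W {K} → 1 + 12 * pairs K ≤ 2 ^ W → 0 < W → Unique K → All (_< 2 ^ W) K →
  ∃ λ l → ∃ λ a → l ≤ W × 2 ^ l ≤ 1 + 12 * pairs K ×
  (∀ {x y} → x ∈ K → y ∈ K → hash W a (W ∸ l) x ≡ hash W a (W ∸ l) y → x ≡ y)
injective-hash W@(suc W′) {K} room _ K! K< with power-above (6 * pairs K)
... | l , 6p< , ≤6p with Universal.few-collisions W′ {K} l (2^-cancel-≤ (≤-trans ≤12p room)) K! K<
  where ≤12p = subst (λ k → 2 ^ l ≤ suc k) (sym (*-assoc 2 6 (pairs K))) ≤6p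
... | a , few = l , a , 2^-cancel-≤ (≤-trans ≤12p room) , ≤12p ,
    collisions≡0⇒injective (hash W a (W ∸ l)) K (n<1⇒n≡0 (*-cancelʳ-< (2 ^ l) _ 1
      (≤-<-trans few (subst (6 * pairs K <_) (sym (*-identityˡ (2 ^ l))) 6p<))))
  where ≤12p = subst (λ k → 2 ^ l ≤ suc k) (sym (*-assoc 2 6 (pairs K))) ≤6p

-- There are at most `k * k / 2` pairs for `k` keys, so more than `k` slots leave only linearly many
-- collisions. This keeps the sum of the quadratic second-level tables linear.
bucket-hash : ∀ W {K} → 1 + 2 * length K ≤ 2 ^ W → 0 < W → 0 < length K → Unique K → All (_< 2 ^ W) K →
  ∃ λ l → ∃ λ a → l ≤ W × 2 ^ l ≤ 1 + 2 * length K × collisions (hash W a (W ∸ l)) K ≤ 3 * length K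
bucket-hash W@(suc W′) {K} room _ 0<k K! K< with power-above (length K)
... | l , k< , ≤k with Universal.few-collisions W′ {K} l (2^-cancel-≤ (≤-trans ≤k room)) K! K<
... | a , few = l , a , 2^-cancel-≤ (≤-trans ≤k room) , ≤k , *-cancelʳ-≤ C (3 * k) k {{>-nonZero 0<k}} (begin
    C * k                 ≤⟨ *-monoʳ-≤ C (<⇒≤ k<) ⟩
    C * 2 ^ l             ≤⟨ few ⟩
    6 * pairs K           ≡⟨ *-assoc 3 2 (pairs K) ⟩
    3 * (2 * pairs K)     ≤⟨ *-monoʳ-≤ 3 (2*pairs≤ K) ⟩
    3 * (k * k)           ≡⟨ sym (*-assoc 3 k k) ⟩
    3 * k * k             ∎)
  where
  open ≤-Reasoning
  k = length K
  C = collisions (hash W a (W ∸ l)) K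

-- Hash tables in memory

module _ {A : Set} where

  read-++ˡ : ∀ (xs : List A) {ys i x} → read xs i ≡ just x → read (xs ++ ys) i ≡ just x
  read-++ˡ []       {i = zero}  ()
  read-++ˡ []       {i = suc _} ()
  read-++ˡ (x ∷ xs) {i = zero}  eqn = eqn
  read-++ˡ (x ∷ xs) {i = suc i} eqn = read-++ˡ xs {i = i} eqn

  read-++ʳ : ∀ (xs : List A) {ys} i → read (xs ++ ys) (length xs + i) ≡ read ys i
  read-++ʳ []       i = refl
  read-++ʳ (x ∷ xs) i = read-++ʳ xs i

  read-< : ∀ (xs : List A) {i x} → read xs i ≡ just x → i < length xs
  read-< []       {zero}  ()
  read-< []       {suc i} ()
  read-< (x ∷ xs) {zero}  eqn = s≤s z≤n
  read-< (x ∷ xs) {suc i} eqn = s≤s (read-< xs eqn)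

  read-map : ∀ {B : Set} (f : A → B) xs i {x} → read xs i ≡ just x → read (map f xs) i ≡ just (f x)
  read-map f (x ∷ xs) zero    refl = refl
  read-map f (x ∷ xs) (suc i) eqn   = read-map f xs i eqn
  read-map f []       zero    ()
  read-map f []       (suc i) ()

  read-applyUpTo : ∀ (f : ℕ → A) {n i} → i < n → read (applyUpTo f n) i ≡ just (f i)
  read-applyUpTo f {suc n} {zero}  _         = refl
  read-applyUpTo f {suc n} {suc i} (s≤s i<n) = read-applyUpTo (f ∘ suc) i<n

module Memory (V : Set) (ε : V) where

  -- The two address spaces of the machine are filled in parallel: every address carries a word and
  -- a utility, so one pointer serves for both, at the cost of doubling the size.
  Cell Mem : Set
  Cell = ℕ × V
  Mem  = List Cell

  At : Mem → ℕ → ℕ → Set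
  At mem i w = ∃ λ u → read mem i ≡ just (w , u)

  record Segment (mem : Mem) (o : ℕ) (ys : List Cell) : Set where
    constructor segment
    field
      cell : ∀ i {c} → read ys i ≡ just c → read mem (o + i) ≡ just c

  open Segment

  segment-++ˡ : ∀ {mem o} ys {zs} → Segment mem o (ys ++ zs) → Segment mem o ys
  segment-++ˡ ys seg = segment λ i eqn → cell seg i (read-++ˡ ys {i = i} eqn)

  segment-++ʳ : ∀ {mem o} ys {zs} → Segment mem o (ys ++ zs) → Segment mem (o + length ys) zs
  segment-++ʳ {mem} {o} ys seg = segment λ i eqn →
    trans (cong (read mem) (+-assoc o (length ys) i)) (cell seg (length ys + i) (trans (read-++ʳ ys i) eqn))

  -- Pointers are absolute, so the cells may depend on the offset `o`. As `R` must hold in every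
  -- memory that contains them there, structures can be placed side by side without disturbing each
  -- other.
  Allocatable : ℕ → (Mem → ℕ → Set) → Set
  Allocatable s R = ∀ o → ∃ λ ys → ∃ λ v → length ys ≤ s × (∀ {mem} → Segment mem o ys → R mem v)

  allocate-all : ∀ K (s : ℕ → ℕ) (R : ℕ → Mem → ℕ → Set) → (∀ {a} → a ∈ K → Allocatable (s a) (R a)) →
                 ∀ o → ∃ λ ys → ∃ λ (addr : ℕ → ℕ) → length ys ≤ ∑ K s ×
                 (∀ {mem} → Segment mem o ys → ∀ {a} → a ∈ K → R a mem (addr a))
  allocate-all []      s R alloc o = [] , (λ _ → 0) , z≤n , λ _ ()
  allocate-all (a ∷ K) s R alloc o with alloc (here refl) o
  ... | ys , v , ys≤ , Rv with allocate-all K s R (alloc ∘ there) (o + length ys)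
  ... | zs , addr , zs≤ , Rzs = ys ++ zs , addr′ ,
        subst (_≤ s a + ∑ K s) (sym (length-++ ys)) (+-mono-≤ ys≤ zs≤) , spec
    where
    addr′ : ℕ → ℕ
    addr′ b with b ≟ a
    ... | yes _ = v
    ... | no  _ = addr b
    spec : ∀ {mem} → Segment mem o (ys ++ zs) → ∀ {b} → b ∈ a ∷ K → R b mem (addr′ b)
    spec seg {b} b∈ with b ≟ a | b∈
    ... | yes refl | _           = Rv (segment-++ˡ ys seg)
    ... | no  b≢a  | here b≡a    = contradiction b≡a b≢a
    ... | no  _    | there b∈K   = Rzs (segment-++ʳ ys seg) b∈K

  -- The query program relies on these offsets. The item is a text position below the node, used for
  -- the final comparison; the utility shares the cell of the depth.
  nodeCells : (depth multiplier shift table item : ℕ) → V → List Cell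
  nodeCells d a t base x u = (d , u) ∷ (a , ε) ∷ (t , ε) ∷ (base , ε) ∷ (x , ε) ∷ []

  -- An empty bucket points to address 0, where a descent can safely stop.
  slot : (ℕ → ℕ) → List ℕ → ℕ
  slot g []      = 0
  slot g (x ∷ _) = g x

  slot-∈ : ∀ g {xs y} → y ∈ xs → (∀ {x} → x ∈ xs → x ≡ y) → slot g xs ≡ g y
  slot-∈ g {x ∷ xs} _ all≡y = cong g (all≡y (here refl))

  slot-range : ∀ g xs → slot g xs ≡ 0 ⊎ ∃ λ y → y ∈ xs × slot g xs ≡ g y
  slot-range g []       = inj₁ refl
  slot-range g (x ∷ xs) = inj₂ (x , here refl , refl)

  module Hashing (W : ℕ) where

    -- The table entry of a letter is not accompanied by the letter itself: a walk for a letter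
    -- that does not label a child goes astray, and only the final comparison with the text notices.
    record Hop (mem : Mem) (y v v′ : ℕ) : Set where
      field
        {a t base} : ℕ
        t≤W        : t ≤ W
        multiplier : At mem (v + 1) a
        shift      : At mem (v + 2) t
        table      : At mem (v + 3) base
        target     : At mem (base + hash W a t y) v′

    -- The bound `d ≤ n` on arrival keeps the last depth below `2 ^ W`, so that the loop test of the
    -- machine compares it faithfully with `m`.
    data Walk (n : ℕ) (mem : Mem) (Q : ℕ → ℕ) (m : ℕ) : (v v′ k : ℕ) → Set where
      arrive : ∀ {v d} → At mem v d → d ≤ n → m ≤ d → Walk n mem Q m v v 0
      hop    : ∀ {v v′ v″ d k} → At mem v d → d < m → Hop mem (Q d) v v′ →
               Walk n mem Q m v′ v″ k → Walk n mem Q m v v″ (suc k)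

    hashNode : ∀ (d a l x : ℕ) (u : V) (F : ℕ → ℕ) o → List Cell
    hashNode d a l x u F o = nodeCells d a (W ∸ l) (o + 5) x u ++ applyUpTo (λ j → F j , ε) (2 ^ l)

    length-hashNode : ∀ d a l x u F o → length (hashNode d a l x u F o) ≡ 5 + 2 ^ l
    length-hashNode d a l x u F o = cong (5 +_) (length-applyUpTo (λ j → F j , ε) (2 ^ l))

    hashNode-hop : ∀ {mem d a l x u F o} → l ≤ W → Segment mem o (hashNode d a l x u F o) →
                   ∀ y → Hop mem y o (F (hash W a (W ∸ l) y))
    hashNode-hop {d = d} {a} {l} {x} {u} {F} {o} l≤W seg y = record
      { t≤W        = m∸n≤m W l
      ; multiplier = ε , cell seg 1 refl
      ; shift      = ε , cell seg 2 refl
      ; table      = ε , cell seg 3 refl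
      ; target     = ε , cell (segment-++ʳ (nodeCells d a (W ∸ l) (o + 5) x u) seg)
          (hash W a (W ∸ l) y) (read-applyUpTo (λ j → F j , ε) (hash-< W l a y l≤W))
      }

    -- The second component is for absent letters: the hop still ends at address 0 or at a genuine
    -- child, so the walk never leaves well-formed memory.
    Selects : List ℕ → (ℕ → ℕ) → ℕ → ℕ → Set
    Selects K g y v = (y ∈ K → v ≡ g y) × (v ≡ 0 ⊎ ∃ λ x → x ∈ K × v ≡ g x)

    BucketNode : ℕ → List ℕ → (ℕ → ℕ) → Mem → ℕ → Set
    BucketNode d K g mem v = At mem v d × (∀ y → ∃ λ v′ → Hop mem y v v′ × Selects K g y v′)

    allocate-bucket : ∀ d K g → 0 < W → 1 + 12 * pairs K ≤ 2 ^ W → Unique K → All (_< 2 ^ W) K →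
                      Allocatable (6 + 12 * pairs K) (BucketNode d K g)
    allocate-bucket d K g 0<W room K! K< o with injective-hash W room 0<W K! K<
    ... | l , a , l≤W , 2^l≤ , h-inj = hashNode d a l 0 ε F o , o ,
          subst (_≤ 6 + 12 * pairs K) (sym (length-hashNode d a l 0 ε F o)) (+-monoʳ-≤ 5 2^l≤) ,
          λ {mem} seg → (ε , trans (cong (read mem) (sym (+-identityʳ o))) (cell seg 0 refl)) ,
            λ y → F (h y) , hashNode-hop l≤W seg y , selects y
      where
      h = hash W a (W ∸ l)
      F : ℕ → ℕ
      F j = slot g (bucket h K j)
      selects : ∀ y → Selects K g y (F (h y))
      selects y = (λ y∈ → slot-∈ g (∈-filter⁺ (λ x → h x ≟ h y) y∈ refl)
          λ x∈ → let x∈K , hx≡hy = ∈-filter⁻ (λ x → h x ≟ h y) {xs = K} x∈ in h-inj x∈K y∈ hx≡hy)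
        , [ inj₁ , (λ (x , x∈ , eqn) → inj₂ (x , proj₁ (∈-filter⁻ (λ x → h x ≟ h y) {xs = K} x∈) , eqn)) ]′
            (slot-range g (bucket h K (h y)))

    DictNode : ℕ → ℕ → V → List ℕ → (ℕ → ℕ) → Mem → ℕ → Set
    DictNode d x u K g mem v = read mem v ≡ just (d , u) × At mem (v + 4) x ×
      (∀ y → ∃ λ v₁ → ∃ λ v₂ → Hop mem y v v₁ × At mem v₁ d × Hop mem y v₁ v₂ × Selects K g y v₂)

    module Dictionary (d x : ℕ) (u : V) (K : List ℕ) (g : ℕ → ℕ) (0<W : 0 < W) (room : 1 + 36 * length K ≤ 2 ^ W)
      (K! : Unique K) (K< : All (_< 2 ^ W) K) (l a : ℕ) (l≤W : l ≤ W) (2^l≤ : 2 ^ l ≤ 1 + 2 * length K)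
      (coll≤ : collisions (hash W a (W ∸ l)) K ≤ 3 * length K) (o : ℕ) where

      open ≤-Reasoning

      k  = length K
      h  = hash W a (W ∸ l)
      ts = upTo (2 ^ l)

      size : ℕ → ℕ
      size t = 6 + 12 * pairs (bucket h K t)

      ∑-pairs≤ : ∑ ts (λ t → pairs (bucket h K t)) ≤ 3 * k
      ∑-pairs≤ = ≤-trans (∑-pairs-bucket≤ h K (Unique.upTo⁺ (2 ^ l))) coll≤

      ∑-size≤ : ∑ ts size ≤ 2 ^ l * 6 + 12 * (3 * k)
      ∑-size≤ = begin
        ∑ ts size                                                   ≡⟨ ∑-+ ts (λ _ → 6) _ ⟩
        ∑ ts (λ _ → 6) + ∑ ts (λ t → 12 * pairs (bucket h K t))     ≡⟨ cong₂ _+_ (trans (∑-const ts 6) (cong (_* 6) (length-upTo (2 ^ l)))) (∑-*ˡ ts 12 _) ⟩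
        2 ^ l * 6 + 12 * ∑ ts (λ t → pairs (bucket h K t))          ≤⟨ +-monoʳ-≤ (2 ^ l * 6) (*-monoʳ-≤ 12 ∑-pairs≤) ⟩
        2 ^ l * 6 + 12 * (3 * k)                                    ∎

      alloc-bucket : ∀ {t} → t ∈ ts → Allocatable (size t) (BucketNode d (bucket h K t) g)
      alloc-bucket {t} t∈ = allocate-bucket d (bucket h K t) g 0<W (≤-trans (s≤s 12*pairs≤) room)
        (Unique.filter⁺ (λ x → h x ≟ t) K!) (All.filter⁺ (λ x → h x ≟ t) K<)
        where
        -- Origin of the 36: even if all of the at most `3 * k` colliding pairs fall into one
        -- bucket, its table must not exceed `2 ^ W`.
        12*pairs≤ : 12 * pairs (bucket h K t) ≤ 36 * k
        12*pairs≤ = begin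
          12 * pairs (bucket h K t)                  ≤⟨ *-monoʳ-≤ 12 (≤-trans (∈⇒≤∑ (λ t → pairs (bucket h K t)) t∈) ∑-pairs≤) ⟩
          12 * (3 * k)                               ≡⟨ sym (*-assoc 12 3 k) ⟩
          36 * k                                     ∎

      buckets = allocate-all ts size (λ t → BucketNode d (bucket h K t) g) alloc-bucket o
      ys      = proj₁ buckets
      addr    = proj₁ (proj₂ buckets)
      ys≤     = proj₁ (proj₂ (proj₂ buckets))
      -- The top table stores the addresses of the buckets and is therefore laid out behind them.
      top     = hashNode d a l x u addr (o + length ys)

      length≤ : length (ys ++ top) ≤ 50 * k + 12
      length≤ = begin
        length (ys ++ top)                           ≡⟨ trans (length-++ ys) (cong (length ys +_) (length-hashNode d a l x u addr (o + length ys))) ⟩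
        length ys + (5 + 2 ^ l)                      ≤⟨ +-monoˡ-≤ (5 + 2 ^ l) (≤-trans ys≤ ∑-size≤) ⟩
        2 ^ l * 6 + 12 * (3 * k) + (5 + 2 ^ l)
          ≡⟨ solve 2 (λ r k → r :* con 6 :+ con 12 :* (con 3 :* k) :+ (con 5 :+ r) := con 7 :* r :+ (con 36 :* k :+ con 5)) refl (2 ^ l) k ⟩
        7 * 2 ^ l + (36 * k + 5)                     ≤⟨ +-monoˡ-≤ (36 * k + 5) (*-monoʳ-≤ 7 2^l≤) ⟩
        7 * (1 + 2 * k) + (36 * k + 5)
          ≡⟨ solve 1 (λ k → con 7 :* (con 1 :+ con 2 :* k) :+ (con 36 :* k :+ con 5) := con 50 :* k :+ con 12) refl k ⟩
        50 * k + 12                                  ∎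

      dictNode : ∀ {mem} → Segment mem o (ys ++ top) → DictNode d x u K g mem (o + length ys)
      dictNode {mem} seg =
        trans (cong (read mem) (sym (+-identityʳ (o + length ys)))) (cell segᵗ 0 refl) , (ε , cell segᵗ 4 refl) ,
        λ y → let at , hops             = proj₂ (proj₂ (proj₂ buckets)) (segment-++ˡ ys seg) (∈-upTo⁺ (hash-< W l a y l≤W))
                  v₂ , hop₂ , sel , range = hops y
              in addr (h y) , v₂ , hashNode-hop l≤W segᵗ y , at , hop₂ ,
                 (λ y∈ → sel (∈-filter⁺ (λ x → h x ≟ h y) y∈ refl)) ,
                 [ inj₁ , (λ (x , x∈ , eqn) → inj₂ (x , proj₁ (∈-filter⁻ (λ x → h x ≟ h y) {xs = K} x∈) , eqn)) ]′ range
        where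
        segᵗ : Segment mem (o + length ys) top
        segᵗ = segment-++ʳ ys seg

    -- Two-level perfect hashing of Fredman, Komlós and Szemerédi; both levels have the
    -- format of a tree node, so a dictionary look-up is two hops at the same depth.
    allocate-dict : ∀ d x u K g → 0 < W → 1 + 36 * length K ≤ 2 ^ W → 0 < length K → Unique K → All (_< 2 ^ W) K →
                    Allocatable (50 * length K + 12) (DictNode d x u K g)
    allocate-dict d x u K g 0<W room 0<k K! K< o =
      let l , a , l≤W , 2^l≤ , coll≤ = bucket-hash W (≤-trans (s≤s (*-monoˡ-≤ (length K) (m≤m+n 2 34))) room) 0<W 0<k K! K<
          open Dictionary d x u K g 0<W room K! K< l a l≤W 2^l≤ coll≤ o
      in ys ++ top , o + length ys , length≤ , dictNode

-- Suffix trees in memory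

filter-⊆ : ∀ {P Q : ℕ → Set} (P? : ∀ x → Dec (P x)) (Q? : ∀ x → Dec (Q x)) xs →
           (∀ {x} → x ∈ xs → P x → Q x) → filter P? (filter Q? xs) ≡ filter P? xs
filter-⊆ P? Q? [] P⊆Q = refl
filter-⊆ P? Q? (x ∷ xs) P⊆Q with Q? x
... | no ¬q with P? x
...   | yes p = contradiction (P⊆Q (here refl) p) ¬q
...   | no  _ = filter-⊆ P? Q? xs (P⊆Q ∘ there)
filter-⊆ P? Q? (x ∷ xs) P⊆Q | yes _ with P? x
...   | yes _ = cong (x ∷_) (filter-⊆ P? Q? xs (P⊆Q ∘ there))
...   | no  _ = filter-⊆ P? Q? xs (P⊆Q ∘ there)

-- One construction serves both trees: `L i j` is letter `j` of the string that belongs to item `i`,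
-- or `nothing` past its end, and `sumOf` is what a node stores about the items below it.
module Trie (V : Set) (ε : V) (W n : ℕ) (L : ℕ → ℕ → Maybe ℕ) (sumOf : List ℕ → V)
            (0<W : 0 < W) (room : 1 + 36 * n ≤ 2 ^ W) (L< : ∀ {i j a} → L i j ≡ just a → a < 2 ^ W) where

  open Memory V ε
  open Hashing W

  _≟ᴹ_ : (a b : Maybe ℕ) → Dec (a ≡ b)
  _≟ᴹ_ = ≡-dec _≟_

  Match : (ℕ → ℕ) → ℕ → ℕ → Set
  Match Q m i = ∀ {j} → j < m → L i j ≡ just (Q j)

  match? : ∀ Q m i → Dec (Match Q m i)
  match? Q m i = allUpTo? (λ j → L i j ≟ᴹ just (Q j)) m

  Agree : List ℕ → ℕ → Set
  Agree S d = ∀ {x y} → x ∈ S → y ∈ S → ∀ {j} → j < d → L x j ≡ L y j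

  -- `correct` assumes that some item matches, since a walk gone astray promises nothing about its
  -- value. Its first conclusion makes the single stored item a test for whether any item of `S`
  -- matches.
  record Located (mem : Mem) (S : List ℕ) (d₀ v : ℕ) (Q : ℕ → ℕ) (m : ℕ) : Set where
    field
      {end steps item} : ℕ
      {value} : V
      walk    : Walk n mem Q m v end steps
      steps≤  : steps ≤ 2 * (m ∸ d₀)
      at-item : At mem (end + 4) item
      item<n  : item < n
      at-value : ∃ λ d → read mem end ≡ just (d , value)
      correct : ∀ {i} → i ∈ S → Match Q m i → Match Q m item × value ≡ sumOf (filter (match? Q m) S)

  Locates : List ℕ → ℕ → Mem → ℕ → Set
  Locates S d₀ mem v = ∀ Q m → m ≤ n → Located mem S d₀ v Q m

  letters : ℕ → List ℕ → List ℕ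
  letters d [] = []
  letters d (x ∷ S) with L x d
  ... | just a  = a ∷ letters d S
  ... | nothing = letters d S

  ∈-letters⁺ : ∀ {d x a S} → x ∈ S → L x d ≡ just a → a ∈ letters d S
  ∈-letters⁺ {d} {x} (here refl) eqn with L x d | eqn
  ... | just a | refl = here refl
  ∈-letters⁺ {d} {S = y ∷ S} (there x∈) eqn with L y d
  ... | just _  = there (∈-letters⁺ x∈ eqn)
  ... | nothing = ∈-letters⁺ x∈ eqn

  ∈-letters⁻ : ∀ {d a} S → a ∈ letters d S → ∃ λ x → x ∈ S × L x d ≡ just a
  ∈-letters⁻ {d} (x ∷ S) a∈ with L x d in eqn | a∈
  ... | just _  | here refl = x , here refl , eqn
  ... | just _  | there a∈′ = let y , y∈ , eqn′ = ∈-letters⁻ S a∈′ in y , there y∈ , eqn′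
  ... | nothing | a∈′       = let y , y∈ , eqn′ = ∈-letters⁻ S a∈′ in y , there y∈ , eqn′

  keys : ℕ → List ℕ → List ℕ
  keys d S = deduplicate _≟_ (letters d S)

  -- An item whose string ends at depth `d` enters no child; this replaces a terminating letter, and
  -- a branching node may then have just one child.
  child : ℕ → List ℕ → ℕ → List ℕ
  child d S a = filter (λ x → L x d ≟ᴹ just a) S

  count-key≤1 : ∀ {K} (b : Maybe ℕ) → Unique K → count (λ a → b ≟ᴹ just a) K ≤ 1
  count-key≤1 {[]}    b _ = z≤n
  count-key≤1 {a ∷ K} b (a∉ ∷ K!) = ≤-trans (≤-reflexive (count-∷ (λ a → b ≟ᴹ just a) a K)) (go (b ≟ᴹ just a))
    where
    zeros : b ≡ just a → ∀ {K′} → All (a ≢_) K′ → count (λ a → b ≟ᴹ just a) K′ ≤ 0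
    zeros eqn [] = z≤n
    zeros eqn {c ∷ K′} (a≢c ∷ a∉) = ≤-trans (≤-reflexive (count-∷ (λ a → b ≟ᴹ just a) c K′)) (go′ (b ≟ᴹ just c))
      where
      go′ : (c? : Dec (b ≡ just c)) → indicator c? + count (λ a → b ≟ᴹ just a) K′ ≤ 0
      go′ (yes eqn′) = contradiction (just-injective (trans (sym eqn) eqn′)) a≢c
      go′ (no _)    = zeros eqn a∉
    go : (a? : Dec (b ≡ just a)) → indicator a? + count (λ a → b ≟ᴹ just a) K ≤ 1
    go (yes eqn) = s≤s (zeros eqn a∉)
    go (no _)   = count-key≤1 b K!

  ∑-child≤ : ∀ d S {K} → Unique K → ∑ K (λ a → length (child d S a)) ≤ length S
  ∑-child≤ d S {K} K! = begin
    ∑ K (λ a → count (λ x → L x d ≟ᴹ just a) S)     ≡⟨ ∑-count-comm (λ a x → L x d ≟ᴹ just a) K S ⟩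
    ∑ S (λ x → count (λ a → L x d ≟ᴹ just a) K)     ≤⟨ ∑-mono S (λ {x} _ → count-key≤1 (L x d) K!) ⟩
    ∑ S (λ _ → 1)                                   ≡⟨ trans (∑-const S 1) (*-identityʳ _) ⟩
    length S                                        ∎
    where open ≤-Reasoning

  -- Path compression: the depth advances while all items agree, and `k` counts the depths left
  -- below `n`. Patterns are no longer than `n`, so items that agree up to there can share one leaf.
  diverge : ∀ x S k d → d + k ≡ n → Agree (x ∷ S) d →
            Agree (x ∷ S) n ⊎ ∃ λ d′ → d ≤ d′ × d′ < n × Agree (x ∷ S) d′ × Any (λ y → L y d′ ≢ L x d′) (x ∷ S)
  diverge x S zero    d d+k≡n agree = inj₁ (subst (Agree (x ∷ S)) (trans (sym (+-identityʳ d)) d+k≡n) agree)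
  diverge x S (suc k) d d+k≡n agree with All.all? (λ y → L y d ≟ᴹ L x d) (x ∷ S)
  ... | no ¬all = inj₂ (d , ≤-refl , subst (d <_) d+k≡n (m<m+n d z<s) , agree , ¬All⇒Any¬ (λ y → L y d ≟ᴹ L x d) (x ∷ S) ¬all)
  ... | yes all with diverge x S k (suc d) (trans (sym (+-suc d k)) d+k≡n) agree′
    where
    agree′ : Agree (x ∷ S) (suc d)
    agree′ y∈ z∈ {j} j<sd with m<1+n⇒m<n∨m≡n j<sd
    ... | inj₁ j<d  = agree y∈ z∈ j<d
    ... | inj₂ refl = trans (All.lookup all y∈) (sym (All.lookup all z∈))
  ... | inj₁ agree = inj₁ agree
  ... | inj₂ (d′ , d<d′ , rest) = inj₂ (d′ , <⇒≤ d<d′ , rest)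

  -- `2 * s ∸ 1` is the number of nodes of a binary tree with `s` leaves, and 112 is the cost
  -- `50 * 2 + 12` of a dictionary with two keys.
  space : List ℕ → ℕ
  space S = 112 * (2 * length S ∸ 1)

  -- `N` is what the children have used of the budget, in units of 112. With `q` the slack in the
  -- second hypothesis, `1 + q` units remain; the first hypothesis gives `k ≤ 2 + q`, so each key
  -- beyond two costs 50 and finds a further unit of 112.
  space-bound : ∀ N k s → N + k ≤ 2 * s → N + 2 ≤ 2 * s → 112 * N + (50 * k + 12) ≤ 112 * (2 * s ∸ 1)
  space-bound N k s N+k≤ N+2≤ with m≤n⇒∃[o]m+o≡n N+2≤
  ... | q , eqn = begin
    112 * N + (50 * k + 12)              ≤⟨ +-monoʳ-≤ (112 * N) (+-monoˡ-≤ 12 (*-monoʳ-≤ 50 k≤)) ⟩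
    112 * N + (50 * (2 + q) + 12)        ≤⟨ +-monoʳ-≤ (112 * N) (subst₂ _≤_
      (solve 1 (λ q → con 112 :+ con 50 :* q := con 50 :* (con 2 :+ q) :+ con 12) refl q)
      (solve 1 (λ q → con 112 :+ con 112 :* q := con 112 :* (con 1 :+ q)) refl q)
      (+-monoʳ-≤ 112 (*-monoˡ-≤ q (m≤m+n 50 62)))) ⟩
    112 * N + 112 * (1 + q)              ≡⟨ sym (*-distribˡ-+ 112 N (1 + q)) ⟩
    112 * (N + (1 + q))                  ≡⟨ cong (λ z → 112 * (z ∸ 1)) (trans (solve 2 (λ N q → con 1 :+ (N :+ (con 1 :+ q)) := N :+ con 2 :+ q) refl N q) eqn) ⟩
    112 * (2 * s ∸ 1)                    ∎
    where
    open ≤-Reasoning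
    k≤ : k ≤ 2 + q
    k≤ = +-cancelˡ-≤ N k (2 + q) (≤-trans N+k≤ (≤-reflexive (trans (sym eqn) (+-assoc N 2 q))))

  leaf : ∀ x S d₀ → x < n → Agree (x ∷ S) n → Allocatable 5 (Locates (x ∷ S) d₀)
  leaf x S d₀ x<n agree o = nodeCells n 0 0 0 x u , o , ≤-refl , λ {mem} seg Q m m≤n →
    let at : read mem o ≡ just (n , u)
        at = trans (cong (read mem) (sym (+-identityʳ o))) (Segment.cell seg 0 refl)
    in record
      { walk     = arrive (u , at) ≤-refl m≤n
      ; steps≤   = z≤n
      ; at-item  = ε , Segment.cell seg 4 refl
      ; item<n   = x<n
      ; at-value = n , at
      ; correct  = λ i∈ match →
          (λ j<m → trans (agree (here refl) i∈ (<-≤-trans j<m m≤n)) (match j<m)) ,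
          cong sumOf (sym (filter-all (match? Q m) (All.tabulate λ y∈ {j} j<m → trans (agree y∈ i∈ (<-≤-trans j<m m≤n)) (match j<m))))
      }
    where u = sumOf (x ∷ S)

  -- The target of empty hash slots.
  DummyLeaf : Mem → Set
  DummyLeaf mem = At mem 0 n × At mem 4 0

  Tree : List ℕ → ℕ → Mem → ℕ → Set
  Tree S d₀ mem v = DummyLeaf mem → Locates S d₀ mem v

  module Branch (x : ℕ) (S₀ : List ℕ) (S≤n : suc (length S₀) ≤ n) (x<n : x < n)
    (d₀ d : ℕ) (d₀≤d : d₀ ≤ d) (d<n : d < n) (agree : Agree (x ∷ S₀) d)
    (differ : Any (λ y → L y d ≢ L x d) (x ∷ S₀))
    where

    open ≤-Reasoning

    S = x ∷ S₀
    K = keys d S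

    K! : Unique K
    K! = UniqueDec.deduplicate-! _≟_ (letters d S)

    ∈-keys⁺ : ∀ {y a} → y ∈ S → L y d ≡ just a → a ∈ K
    ∈-keys⁺ y∈ eqn = ∈-deduplicate⁺ _≟_ (∈-letters⁺ y∈ eqn)

    ∈-keys⁻ : ∀ {a} → a ∈ K → ∃ λ y → y ∈ S × L y d ≡ just a
    ∈-keys⁻ a∈ = ∈-letters⁻ S (∈-deduplicate⁻ _≟_ (letters d S) a∈)

    K< : All (_< 2 ^ W) K
    K< = All.tabulate λ a∈ → let y , _ , eqn = ∈-keys⁻ a∈ in L< eqn

    0<child : ∀ {a} → a ∈ K → 1 ≤ length (child d S a)
    0<child {a} a∈ = let y , y∈ , eqn = ∈-keys⁻ a∈ in ∈-length (∈-filter⁺ (λ y → L y d ≟ᴹ just a) y∈ eqn)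

    child<S : ∀ a → length (child d S a) < length S
    child<S a = filter-notAll (λ y → L y d ≟ᴹ just a) S (go (L x d ≟ᴹ just a))
      where
      go : Dec (L x d ≡ just a) → Any (λ y → ¬ L y d ≡ just a) S
      go (yes eqn) = Any.map (λ y≢x eqn′ → y≢x (trans eqn′ (sym eqn))) differ
      go (no ≢)   = here ≢

    0<K : 0 < length K
    0<K = go (L x d) refl differ
      where
      go : ∀ b → L x d ≡ b → Any (λ y → L y d ≢ L x d) S → 0 < length K
      go (just a) eqn _      = ∈-length (∈-keys⁺ (here refl) eqn)
      go nothing  eqn differ =
        let y , y∈ , y≢x = find differ in go′ (L y d) refl y∈ y≢x
        where
        go′ : ∀ {y} b → L y d ≡ b → y ∈ S → L y d ≢ L x d → 0 < length K
        go′ (just a) eqn′ y∈ _   = ∈-length (∈-keys⁺ y∈ eqn′)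
        go′ nothing  eqn′ _  y≢x = contradiction (trans eqn′ (sym eqn)) y≢x

    N = ∑ K (λ a → 2 * length (child d S a) ∸ 1)

    N+K≡ : N + length K ≡ 2 * ∑ K (λ a → length (child d S a))
    N+K≡ = go K (λ a∈ → 0<child a∈)
      where
      go : ∀ K′ → (∀ {a} → a ∈ K′ → 1 ≤ length (child d S a)) →
           ∑ K′ (λ a → 2 * length (child d S a) ∸ 1) + length K′ ≡ 2 * ∑ K′ (λ a → length (child d S a))
      go []       _  = refl
      go (a ∷ K′) 0< = trans
        (solve 3 (λ p q r → p :+ q :+ (con 1 :+ r) := p :+ con 1 :+ (q :+ r)) refl
          (2 * length (child d S a) ∸ 1) (∑ K′ (λ a → 2 * length (child d S a) ∸ 1)) (length K′))
        (trans (cong₂ _+_ (m∸n+n≡m (≤-trans (0< (here refl)) (m≤n*m _ 2))) (go K′ (0< ∘ there)))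
          (sym (*-distribˡ-+ 2 (length (child d S a)) (∑ K′ (λ a → length (child d S a))))))

    N+K≤ : N + length K ≤ 2 * length S
    N+K≤ = subst (_≤ 2 * length S) (sym N+K≡) (*-monoʳ-≤ 2 (∑-child≤ d S K!))

    -- For two or more keys this is weaker than `N+K≤`. For a single key the missing unit comes from
    -- `child<S`: some item differs from the others at depth `d` and stays outside the child.
    N+2≤ : N + 2 ≤ 2 * length S
    N+2≤ = go K refl 0<K N+K≤ N+K≡
      where
      go : ∀ K′ → K ≡ K′ → 0 < length K′ → N + length K′ ≤ 2 * length S →
           N + length K′ ≡ 2 * ∑ K′ (λ a → length (child d S a)) → N + 2 ≤ 2 * length S
      go (a ∷ []) _ _ _ eqn = begin
        N + 2                                 ≡⟨ sym (+-assoc N 1 1) ⟩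
        N + 1 + 1                             ≤⟨ +-monoʳ-≤ (N + 1) (n≤1+n 1) ⟩
        N + 1 + 2                             ≡⟨ cong (_+ 2) eqn ⟩
        2 * (length (child d S a) + 0) + 2    ≡⟨ solve 1 (λ c → con 2 :* (c :+ con 0) :+ con 2 := con 2 :* (con 1 :+ c)) refl (length (child d S a)) ⟩
        2 * suc (length (child d S a))        ≤⟨ *-monoʳ-≤ 2 (child<S a) ⟩
        2 * length S                          ∎
      go (_ ∷ _ ∷ _) _ _ le _ = ≤-trans (+-monoʳ-≤ N (s≤s (s≤s z≤n))) le

    K≤n : length K ≤ n
    K≤n = begin
      length K                                       ≡⟨ sym (trans (∑-const K 1) (*-identityʳ _)) ⟩
      ∑ K (λ _ → 1)                                  ≤⟨ ∑-mono K 0<child ⟩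
      ∑ K (λ a → length (child d S a))               ≤⟨ ∑-child≤ d S K! ⟩
      length S                                       ≤⟨ S≤n ⟩
      n                                              ∎

    u : V
    u = sumOf S

    located : ∀ {mem v g} → DictNode d x u K g mem v →
              (∀ {a} → a ∈ K → Tree (child d S a) (suc d) mem (g a)) → Tree S d₀ mem v
    located {mem} {v} {g} (at , at-x , hops) trees dummy Q m m≤n with m ≤? d
    -- The pattern ends on the edge into this node or at the node. All items agree on their first
    -- `d` letters, so one match means that all of `S` matches.
    ... | yes m≤d = record
      { walk     = arrive (u , at) (<⇒≤ d<n) m≤d
      ; steps≤   = z≤n
      ; at-item  = at-x
      ; item<n   = x<n
      ; at-value = d , at
      ; correct  = λ i∈ match →
          (λ j<m → trans (agree (here refl) i∈ (<-≤-trans j<m m≤d)) (match j<m)) ,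
          cong sumOf (sym (filter-all (match? Q m) (All.tabulate λ y∈ {j} j<m → trans (agree y∈ i∈ (<-≤-trans j<m m≤d)) (match j<m))))
      }
    ... | no m≰d = descend (hops (Q d))
      where
      d<m = ≰⇒> m≰d
      -- The letter consumed at depth `d` pays for the two hops of the look-up.
      2+≤ : ∀ {k} → k ≤ 2 * (m ∸ suc d) → 2 + k ≤ 2 * (m ∸ d₀)
      2+≤ {k} k≤ = begin
        2 + k                     ≤⟨ +-monoʳ-≤ 2 k≤ ⟩
        2 + 2 * (m ∸ suc d)       ≡⟨ sym (*-distribˡ-+ 2 1 (m ∸ suc d)) ⟩
        2 * (1 + (m ∸ suc d))     ≡⟨ cong (2 *_) (sym (+-∸-assoc 1 d<m)) ⟩
        2 * (m ∸ d)               ≤⟨ *-monoʳ-≤ 2 (∸-monoʳ-≤ m d₀≤d) ⟩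
        2 * (m ∸ d₀)              ∎
      descend : (∃ λ v₁ → ∃ λ v₂ → Hop mem (Q d) v v₁ × At mem v₁ d × Hop mem (Q d) v₁ v₂ × Selects K g (Q d) v₂) →
                Located mem S d₀ v Q m
      descend (v₁ , v₂ , hop₁ , at₁ , hop₂ , select , range) = go (Q d ∈? K) range
        where
        into : ∀ {v₂′ k} → v₂ ≡ v₂′ → ∀ {v″} → Walk n mem Q m v₂′ v″ k → Walk n mem Q m v v″ (2 + k)
        into refl walk = hop (u , at) d<m hop₁ (hop at₁ d<m hop₂ walk)
        absent : ¬ (Q d ∈ K) → ∀ {i} → i ∈ S → Match Q m i → ∀ {A : Set} → A
        absent Qd∉ i∈ match = contradiction (∈-keys⁺ i∈ (match d<m)) Qd∉
        go : Dec (Q d ∈ K) → v₂ ≡ 0 ⊎ (∃ λ a → a ∈ K × v₂ ≡ g a) → Located mem S d₀ v Q m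
        go (yes Qd∈) _ = record
          { walk     = into (select Qd∈) walk
          ; steps≤   = 2+≤ steps≤
          ; at-item  = at-item
          ; item<n   = item<n
          ; at-value = at-value
          ; correct  = λ {i} i∈ match →
              let match′ , value≡ = correct (∈-filter⁺ (λ y → L y d ≟ᴹ just (Q d)) i∈ (match d<m)) match
              in (λ {j} → match′ {j}) , trans value≡ (cong sumOf (filter-⊆ (match? Q m) (λ y → L y d ≟ᴹ just (Q d)) S (λ _ match → match d<m)))
          }
          where open Located (trees Qd∈ dummy Q m m≤n)
        -- The walk strays into the child of another letter. Its length is still bounded, and
        -- `correct` is vacuous, since a matching item would make `Q d` a key.
        go (no Qd∉) (inj₂ (a , a∈ , v₂≡)) = record
          { walk     = into v₂≡ walk
          ; steps≤   = 2+≤ steps≤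
          ; at-item  = at-item
          ; item<n   = item<n
          ; at-value = at-value
          ; correct  = λ i∈ match → absent Qd∉ i∈ match
          }
          where open Located (trees a∈ dummy Q m m≤n)
        go (no Qd∉) (inj₁ v₂≡0) = record
          { walk     = into v₂≡0 (arrive (proj₁ dummy) ≤-refl m≤n)
          ; steps≤   = 2+≤ z≤n
          ; at-item  = proj₂ dummy
          ; item<n   = ≤-<-trans z≤n x<n
          ; at-value = n , proj₂ (proj₁ dummy)
          ; correct  = λ i∈ match → absent Qd∉ i∈ match
          }

    agree-child : ∀ a → Agree (child d S a) (suc d)
    agree-child a y∈ z∈ {j} j<sd with ∈-filter⁻ (λ y → L y d ≟ᴹ just a) {xs = S} y∈ | ∈-filter⁻ (λ y → L y d ≟ᴹ just a) {xs = S} z∈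
    ... | y∈S , y≡ | z∈S , z≡ with m<1+n⇒m<n∨m≡n j<sd
    ... | inj₁ j<d  = agree y∈S z∈S j<d
    ... | inj₂ refl = trans y≡ (sym z≡)

    size≤ : ∀ {p q} → p ≤ ∑ K (λ a → space (child d S a)) → q ≤ 50 * length K + 12 → p + q ≤ space S
    size≤ {p} {q} p≤ q≤ = begin
      p + q                                                      ≤⟨ +-mono-≤ p≤ q≤ ⟩
      ∑ K (λ a → space (child d S a)) + (50 * length K + 12)     ≡⟨ cong (_+ (50 * length K + 12)) (∑-*ˡ K 112 (λ a → 2 * length (child d S a) ∸ 1)) ⟩
      112 * N + (50 * length K + 12)                             ≤⟨ space-bound N (length K) (length S) N+K≤ N+2≤ ⟩
      space S                                                    ∎

    join : ∀ o ys g → length ys ≤ ∑ K (λ a → space (child d S a)) →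
           (∀ {mem} → Segment mem o ys → ∀ {a} → a ∈ K → Tree (child d S a) (suc d) mem (g a)) →
           ∀ zs v → length zs ≤ 50 * length K + 12 →
           (∀ {mem} → Segment mem (o + length ys) zs → DictNode d x u K g mem v) →
           ∃ λ ys → ∃ λ v → length ys ≤ space S × (∀ {mem} → Segment mem o ys → Tree S d₀ mem v)
    join o ys g ys≤ trees zs v zs≤ node = ys ++ zs , v ,
      subst (_≤ space S) (sym (length-++ ys)) (size≤ ys≤ zs≤) ,
      λ seg → located (node (segment-++ʳ ys seg)) (trees (segment-++ˡ ys seg))

    allocate-branch : (∀ {a} → a ∈ K → Allocatable (space (child d S a)) (Tree (child d S a) (suc d))) →
                      Allocatable (space S) (Tree S d₀)
    allocate-branch alloc-child o = children (allocate-all K (λ a → space (child d S a)) (λ a → Tree (child d S a) (suc d)) alloc-child o)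
      where
      children : (∃ λ ys → ∃ λ (g : ℕ → ℕ) → length ys ≤ ∑ K (λ a → space (child d S a)) ×
                   (∀ {mem} → Segment mem o ys → ∀ {a} → a ∈ K → Tree (child d S a) (suc d) mem (g a))) →
                 ∃ λ ys → ∃ λ v → length ys ≤ space S × (∀ {mem} → Segment mem o ys → Tree S d₀ mem v)
      children (ys , g , ys≤ , trees) = dict (allocate-dict d x u K g 0<W (≤-trans (s≤s (*-monoʳ-≤ 36 K≤n)) room) 0<K K! K< (o + length ys))
        where
        dict : (∃ λ zs → ∃ λ v → length zs ≤ 50 * length K + 12 × (∀ {mem} → Segment mem (o + length ys) zs → DictNode d x u K g mem v)) →
               ∃ λ ys → ∃ λ v → length ys ≤ space S × (∀ {mem} → Segment mem o ys → Tree S d₀ mem v)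
        dict (zs , v , zs≤ , node) = join o ys g ys≤ trees zs v zs≤ node

  weaken : ∀ {s s′ R} → s ≤ s′ → Allocatable s R → Allocatable s′ R
  weaken s≤s′ alloc o = let ys , v , ys≤ , R = alloc o in ys , v , ≤-trans ys≤ s≤s′ , R

  -- The recursion is on `g`, a bound for `length S`: as branching happens only where items differ,
  -- every child is strictly smaller. The edge into the node starts at depth `d₀`.
  allocate-tree : ∀ g S d₀ → 0 < length S → length S ≤ g → g ≤ n → All (_< n) S → d₀ ≤ n → Agree S d₀ →
                  Allocatable (space S) (Tree S d₀)
  allocate-tree (suc g) (x ∷ S₀) d₀ _ (s≤s S₀≤g) g<n (x<n ∷ S₀<n) d₀≤n agree
    with diverge x S₀ (n ∸ d₀) d₀ (m+[n∸m]≡n d₀≤n) agree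
  ... | inj₁ agree′ = weaken (≤-trans (m≤m+n 5 107) (*-monoʳ-≤ 112 (1≤ (length S₀)))) λ o →
          let ys , v , ys≤ , R = leaf x S₀ d₀ x<n agree′ o in ys , v , ys≤ , λ seg _ → R seg
    where
    1≤ : ∀ s → 1 ≤ 2 * suc s ∸ 1
    1≤ s = ≤-trans (s≤s z≤n) (m≤n+m (suc s + 0) s)
  ... | inj₂ (d , d₀≤d , d<n , agree′ , differ) = allocate-branch λ {a} a∈ →
          allocate-tree g (child d (x ∷ S₀) a) (suc d) (0<child a∈) (≤-trans (s≤s⁻¹ (child<S a)) S₀≤g)
            (<⇒≤ g<n) (All.filter⁺ (λ y → L y d ≟ᴹ just a) (x<n ∷ S₀<n)) d<n (agree-child a)
    where open Branch x S₀ (≤-trans (s≤s S₀≤g) g<n) x<n d₀ d d₀≤d d<n agree′ differ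

-- The query program

-- `0F` is the current node during a descent, `1F` the pattern length, `8F` tells which descent is
-- running, and `4F` to `7F` are scratch. The utility register `2F` stays zero for the failing exit.
-- Addresses 0, 1 and 2 hold the text length and the two roots; the text starts at address 5.
program : Program
program = record
  { #wordRegs  = 9
  ; #valueRegs = 3
  ; code       =
      patLength 1F
    ∷ const 5F 0
    -- The empty pattern has utility zero, and no last position for the second descent to start
    -- from.
    ∷ jumpIf eq 1F 5F 57
    ∷ const 2F 0
    ∷ const 3F 1
    ∷ const 8F 0
    ∷ const 6F 1
    ∷ loadData 0F 6F
    -- 8: the descent from node 0F, which reads the pattern at the indices 2F + 3F * depth mod 2 ^ W
    ∷ loadData 4F 0F
    ∷ jumpIf lt 4F 1F 11
    ∷ jump 26
    ∷ arith mul 5F 3F 4F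
    ∷ arith add 5F 2F 5F
    ∷ loadPat 5F 5F
    ∷ const 7F 1
    ∷ arith add 6F 0F 7F
    ∷ loadData 4F 6F
    ∷ arith mul 5F 4F 5F
    ∷ arith add 6F 6F 7F
    ∷ loadData 4F 6F
    ∷ arith shr 5F 5F 4F
    ∷ arith add 6F 6F 7F
    ∷ loadData 4F 6F
    ∷ arith add 5F 4F 5F
    ∷ loadData 0F 5F
    ∷ jump 8
    -- 26: end of a descent; in the first one, prepare the comparison of text and pattern
    ∷ loadDataᵛ 0F 0F
    ∷ const 7F 1
    ∷ jumpIf eq 8F 7F 55
    ∷ const 6F 4
    ∷ arith add 6F 0F 6F
    ∷ loadData 4F 6F
    ∷ arith add 5F 4F 1F
    ∷ const 6F 0
    ∷ loadData 0F 6F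
    ∷ jumpIf lt 0F 5F 57
    ∷ const 6F 5
    ∷ arith add 4F 6F 4F
    ∷ const 6F 0
    -- 39: the comparison; 4F is the address of the first letter of the text to compare
    ∷ jumpIf eq 6F 1F 47
    ∷ loadPat 5F 6F
    ∷ arith add 0F 4F 6F
    ∷ loadData 0F 0F
    ∷ jumpIf eq 5F 0F 45
    ∷ jump 57
    ∷ arith add 6F 6F 7F
    ∷ jump 39
    -- 47: set 2F and 3F to m - 1 and - 1 for the second descent
    ∷ moveᵛ 1F 0F
    ∷ arith sub 2F 1F 7F
    ∷ const 3F 0
    ∷ arith sub 3F 3F 7F
    ∷ const 8F 1
    ∷ const 6F 2
    ∷ loadData 0F 6F
    ∷ jump 8
    -- 55: the two exits
    ∷ subᵛ 0F 0F 1F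
    ∷ return 0F
    ∷ return 2F
    ∷ []
  }

-- Arithmetic of machine words

module Words (W : ℕ) where

  instance
    M-nonZero : NonZero (2 ^ W)
    M-nonZero = m^n≢0 2 W

  toℕ-wrap-% : ∀ k → toℕ (wrap W k) ≡ k % 2 ^ W
  toℕ-wrap-% k = toℕ-fromℕ< (m%n<n k (2 ^ W))

  toℕ-wrap : ∀ {k} → k < 2 ^ W → toℕ (wrap W k) ≡ k
  toℕ-wrap {k} k< = trans (toℕ-wrap-% k) (m<n⇒m%n≡m k<)

  wrap-cong : ∀ {j k} → j % 2 ^ W ≡ k % 2 ^ W → wrap W j ≡ wrap W k
  wrap-cong {j} {k} j≡k = toℕ-injective (trans (toℕ-wrap-% j) (trans j≡k (sym (toℕ-wrap-% k))))

  -- Arbitrary naturals are allowed under `wrap`, so overflow is absorbed: the product in the hash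
  -- function and the downward pattern index depend on that.
  eval-add : ∀ a b → evalArith W add (wrap W a) (wrap W b) ≡ just (wrap W (a + b))
  eval-add a b = cong just (wrap-cong (trans
    (cong₂ (λ x y → (x + y) % 2 ^ W) (toℕ-wrap-% a) (toℕ-wrap-% b)) (sym (%-distribˡ-+ a b (2 ^ W)))))

  eval-mul : ∀ a b → evalArith W mul (wrap W a) (wrap W b) ≡ just (wrap W (a * b))
  eval-mul a b = cong just (wrap-cong (trans
    (cong₂ (λ x y → (x * y) % 2 ^ W) (toℕ-wrap-% a) (toℕ-wrap-% b)) (sym (%-distribˡ-* a b (2 ^ W)))))

  eval-shr : ∀ a {t} → t < 2 ^ W → evalArith W shr (wrap W a) (wrap W t) ≡ just (wrap W ((a % 2 ^ W / 2 ^ t) {{m^n≢0 2 t}}))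
  eval-shr a {t} t< rewrite toℕ-wrap-% a | toℕ-wrap t< = refl

  eval-sub : ∀ a b → b < 2 ^ W → evalArith W sub (wrap W a) (wrap W b) ≡ just (wrap W (a + (2 ^ W ∸ b)))
  eval-sub a b b< = cong just (wrap-cong (begin
    (toℕ (wrap W a) + (2 ^ W ∸ toℕ (wrap W b))) % 2 ^ W    ≡⟨ cong₂ (λ x y → (x + (2 ^ W ∸ y)) % 2 ^ W) (toℕ-wrap-% a) (toℕ-wrap b<) ⟩
    (a % 2 ^ W + (2 ^ W ∸ b)) % 2 ^ W                      ≡⟨ %-distribˡ-+ (a % 2 ^ W) (2 ^ W ∸ b) (2 ^ W) ⟩
    (a % 2 ^ W % 2 ^ W + (2 ^ W ∸ b) % 2 ^ W) % 2 ^ W      ≡⟨ cong (λ x → (x + (2 ^ W ∸ b) % 2 ^ W) % 2 ^ W) (m%n%n≡m%n a (2 ^ W)) ⟩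
    (a % 2 ^ W + (2 ^ W ∸ b) % 2 ^ W) % 2 ^ W              ≡⟨ sym (%-distribˡ-+ a (2 ^ W ∸ b) (2 ^ W)) ⟩
    (a + (2 ^ W ∸ b)) % 2 ^ W                              ∎))
    where open ≡-Reasoning

  eval-lt-true : ∀ {a b} → a < b → b < 2 ^ W → evalTest W lt (wrap W a) (wrap W b) ≡ true
  eval-lt-true {a} {b} a<b b< = trans (cong₂ (λ x y → does (x <? y)) (toℕ-wrap (<-trans a<b b<)) (toℕ-wrap b<)) (dec-true (a <? b) a<b)

  eval-lt-false : ∀ {a b} → ¬ a < b → a < 2 ^ W → b < 2 ^ W → evalTest W lt (wrap W a) (wrap W b) ≡ false
  eval-lt-false {a} {b} a≮b a< b< = trans (cong₂ (λ x y → does (x <? y)) (toℕ-wrap a<) (toℕ-wrap b<)) (dec-false (a <? b) a≮b)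

  eval-eq-true : ∀ {a b} → a ≡ b → evalTest W eq (wrap W a) (wrap W b) ≡ true
  eval-eq-true {a} {b} refl = dec-true (toℕ (wrap W a) ≟ toℕ (wrap W a)) refl

  eval-eq-false : ∀ {a b} → a ≢ b → a < 2 ^ W → b < 2 ^ W → evalTest W eq (wrap W a) (wrap W b) ≡ false
  eval-eq-false {a} {b} a≢b a< b< = trans (cong₂ (λ x y → does (x ≟ y)) (toℕ-wrap a<) (toℕ-wrap b<)) (dec-false (a ≟ b) a≢b)

-- Execution traces

module Run {W : ℕ} (P : Program) (D : DataStructure W) (pat : List (Word W)) where

  open Program P renaming (#wordRegs to k; #valueRegs to l)
  open DataStructure D

  -- Quantifying over the remaining fuel makes the composition of traces an addition of their
  -- lengths.
  record Reaches (t : ℕ) (s s′ : State W k l) : Set where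
    constructor reaches
    field
      runs : ∀ t′ → run P D pat (t + t′) s ≡ run P D pat t′ s′

  open Reaches public

  infixr 5 _▸_
  _▸_ : ∀ {t t′ s s′ s″} → Reaches t s s′ → Reaches t′ s′ s″ → Reaches (t + t′) s s″
  _▸_ {t} {t′} {s} f g = reaches λ u →
    trans (cong (λ z → run P D pat z s) (+-assoc t t′ u)) (trans (runs f (t′ + u)) (runs g u))

  stepping : ∀ {s s′} → step P D pat s ≡ continue s′ → Reaches 1 s s′
  stepping {s} {s′} e = reaches go
    where
    go : ∀ t → run P D pat (suc t) s ≡ run P D pat t s′
    go t rewrite e = refl

  fetch : ∀ {instr s s′} → read code (State.pc s) ≡ just instr → execute P D pat instr s ≡ continue s′ → Reaches 1 s s′
  fetch {s = s} i e = stepping (trans (cong (maybe′ (λ instr → execute P D pat instr s) crashed) i) e)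

  module _ {pc : ℕ} {r : Vec (Word W) k} {v : Vec ℝ l} {ww : List (Word W)} {wv : List ℝ} where

    const-step : ∀ {d c} → read code pc ≡ just (const d c) →
      Reaches 1 ⟨ pc , r , v , ww , wv ⟩ ⟨ suc pc , r [ d ]≔ wrap W c , v , ww , wv ⟩
    const-step i = fetch i refl

    patLength-step : ∀ {d} → read code pc ≡ just (patLength d) →
      Reaches 1 ⟨ pc , r , v , ww , wv ⟩ ⟨ suc pc , r [ d ]≔ wrap W (length pat) , v , ww , wv ⟩
    patLength-step i = fetch i refl

    arith-step : ∀ {op d a b x} → read code pc ≡ just (arith op d a b) →
      evalArith W op (lookup r a) (lookup r b) ≡ just x →
      Reaches 1 ⟨ pc , r , v , ww , wv ⟩ ⟨ suc pc , r [ d ]≔ x , v , ww , wv ⟩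
    arith-step {op} {d} {a} {b} {x} i e = fetch i effect
      where
      effect : execute P D pat (arith op d a b) ⟨ pc , r , v , ww , wv ⟩ ≡ continue ⟨ suc pc , r [ d ]≔ x , v , ww , wv ⟩
      effect rewrite e = refl

    loadPat-step : ∀ {d a x} → read code pc ≡ just (loadPat d a) →
      read pat (toℕ (lookup r a)) ≡ just x →
      Reaches 1 ⟨ pc , r , v , ww , wv ⟩ ⟨ suc pc , r [ d ]≔ x , v , ww , wv ⟩
    loadPat-step {d} {a} {x} i e = fetch i effect
      where
      effect : execute P D pat (loadPat d a) ⟨ pc , r , v , ww , wv ⟩ ≡ continue ⟨ suc pc , r [ d ]≔ x , v , ww , wv ⟩
      effect rewrite e = refl

    loadData-step : ∀ {d a x} → read code pc ≡ just (loadData d a) →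
      read words (toℕ (lookup r a)) ≡ just x →
      Reaches 1 ⟨ pc , r , v , ww , wv ⟩ ⟨ suc pc , r [ d ]≔ x , v , ww , wv ⟩
    loadData-step {d} {a} {x} i e = fetch i effect
      where
      effect : execute P D pat (loadData d a) ⟨ pc , r , v , ww , wv ⟩ ≡ continue ⟨ suc pc , r [ d ]≔ x , v , ww , wv ⟩
      effect rewrite e = refl

    loadDataᵛ-step : ∀ {d a x} → read code pc ≡ just (loadDataᵛ d a) →
      read values (toℕ (lookup r a)) ≡ just x →
      Reaches 1 ⟨ pc , r , v , ww , wv ⟩ ⟨ suc pc , r , v [ d ]≔ x , ww , wv ⟩
    loadDataᵛ-step {d} {a} {x} i e = fetch i effect
      where
      effect : execute P D pat (loadDataᵛ d a) ⟨ pc , r , v , ww , wv ⟩ ≡ continue ⟨ suc pc , r , v [ d ]≔ x , ww , wv ⟩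
      effect rewrite e = refl

    moveᵛ-step : ∀ {d a} → read code pc ≡ just (moveᵛ d a) →
      Reaches 1 ⟨ pc , r , v , ww , wv ⟩ ⟨ suc pc , r , v [ d ]≔ lookup v a , ww , wv ⟩
    moveᵛ-step i = fetch i refl

    subᵛ-step : ∀ {d a b} → read code pc ≡ just (subᵛ d a b) →
      Reaches 1 ⟨ pc , r , v , ww , wv ⟩ ⟨ suc pc , r , v [ d ]≔ (lookup v a +ᴿ (-ᴿ lookup v b)) , ww , wv ⟩
    subᵛ-step i = fetch i refl

    jump-step : ∀ {t} → read code pc ≡ just (jump t) →
      Reaches 1 ⟨ pc , r , v , ww , wv ⟩ ⟨ t , r , v , ww , wv ⟩
    jump-step i = fetch i refl

    jumpIf-step : ∀ {q a b t β} → read code pc ≡ just (jumpIf q a b t) →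
      evalTest W q (lookup r a) (lookup r b) ≡ β →
      Reaches 1 ⟨ pc , r , v , ww , wv ⟩ ⟨ (if β then t else suc pc) , r , v , ww , wv ⟩
    jumpIf-step {q} {a} {b} {t} {β} i e = fetch i effect
      where
      effect : execute P D pat (jumpIf q a b t) ⟨ pc , r , v , ww , wv ⟩ ≡ continue ⟨ (if β then t else suc pc) , r , v , ww , wv ⟩
      effect rewrite e = refl

  returning : ∀ {t s pc r v ww wv a} → Reaches t s ⟨ pc , r , v , ww , wv ⟩ → read code pc ≡ just (return a) →
              run P D pat (t + 1) s ≡ just (lookup v a)
  returning {pc = pc} {r} {v} {ww} {wv} {a} reach i = trans (runs reach 1) return-run
    where
    return-run : run P D pat 1 ⟨ pc , r , v , ww , wv ⟩ ≡ just (lookup v a)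
    return-run rewrite i = refl

  run-mono : ∀ {t t′ s u} → t ≤ t′ → run P D pat t s ≡ just u → run P D pat t′ s ≡ just u
  run-mono {zero} _ ()
  run-mono {suc t} {suc t′} {s} (s≤s t≤t′) e with step P D pat s
  ... | continue s′ = run-mono t≤t′ e
  ... | returned x  = e

-- Simulation of a query

structure : ∀ W → List (ℕ × ℝ) → DataStructure W
structure W mem = record
  { words       = map (wrap W ∘ proj₁) mem
  ; values      = map proj₂ mem
  ; #workWords  = 0
  ; #workValues = 0
  }

module Simulation (W : ℕ) (mem : List (ℕ × ℝ)) (mem≤ : length mem ≤ 2 ^ W) (W<2^W : W < 2 ^ W)
                  (8≤2^W : 8 ≤ 2 ^ W) (pat : List (Word W)) where

  open Words W
  open Memory ℝ 0ᴿ
  open Hashing W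
  open Run program (structure W mem) pat

  at-< : ∀ {i w} → At mem i w → i < 2 ^ W
  at-< (_ , e) = <-≤-trans (read-< mem e) mem≤

  load : ∀ {i w} → At mem i w → read (map (wrap W ∘ proj₁) mem) (toℕ (wrap W i)) ≡ just (wrap W w)
  load {i} at@(_ , e) = trans (cong (read _) (toℕ-wrap (at-< at))) (read-map (wrap W ∘ proj₁) mem i e)

  loadᵛ : ∀ {i w u} → read mem i ≡ just (w , u) → read (map proj₂ mem) (toℕ (wrap W i)) ≡ just u
  loadᵛ {i} e = trans (cong (read _) (toℕ-wrap (at-< (_ , e)))) (read-map proj₂ mem i e)

  -- One round of the loop takes 17 instructions. The scratch registers are existential, as each
  -- round overwrites them before use.
  hop-steps : ∀ {v v′ d y m base s f u₀ u₁ u₂ r₄ r₅ r₆ r₇} → At mem v d → d < m → m < 2 ^ W →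
    read pat (toℕ (wrap W (base + s * d))) ≡ just (wrap W y) → Hop mem y v v′ →
    ∃ λ r₄′ → ∃ λ r₅′ → ∃ λ r₆′ → ∃ λ r₇′ →
    Reaches 17
      ⟨ 8 , wrap W v ∷ wrap W m ∷ wrap W base ∷ wrap W s ∷ r₄ ∷ r₅ ∷ r₆ ∷ r₇ ∷ f ∷ [] , u₀ ∷ u₁ ∷ u₂ ∷ [] , [] , [] ⟩
      ⟨ 8 , wrap W v′ ∷ wrap W m ∷ wrap W base ∷ wrap W s ∷ r₄′ ∷ r₅′ ∷ r₆′ ∷ r₇′ ∷ f ∷ [] , u₀ ∷ u₁ ∷ u₂ ∷ [] , [] , [] ⟩
  hop-steps {v} {v′} {d} {y} {m} {base} {s} at d<m m< letter h = _ , _ , _ , _ ,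
      ( loadData-step refl (load at)
      ▸ jumpIf-step refl (eval-lt-true d<m m<)
      ▸ arith-step refl (eval-mul s d)
      ▸ arith-step refl (eval-add base (s * d))
      ▸ loadPat-step refl letter
      ▸ const-step refl
      ▸ arith-step refl (eval-add v 1)
      ▸ loadData-step refl (load multiplier)
      ▸ arith-step refl (eval-mul a y)
      ▸ arith-step refl (eval-add (v + 1) 1)
      ▸ loadData-step refl (load (subst (λ i → At mem i t) (sym (+-assoc v 1 1)) shift))
      ▸ arith-step refl (eval-shr (a * y) (≤-<-trans t≤W W<2^W))
      ▸ arith-step refl (eval-add (v + 1 + 1) 1)
      ▸ loadData-step refl (load (subst (λ i → At mem i table₀) (solve 1 (λ v → v :+ con 3 := v :+ con 1 :+ con 1 :+ con 1) refl v) table))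
      ▸ arith-step refl (eval-add table₀ (hash W a t y))
      ▸ loadData-step refl (load target)
      ▸ jump-step refl )
    where open Hop h renaming (base to table₀)

  walk-steps : ∀ {n Q v v″ k m base s f u₀ u₁ u₂} r₄ r₅ r₆ r₇ → n < 2 ^ W → m < 2 ^ W →
    (∀ {d} → d < m → read pat (toℕ (wrap W (base + s * d))) ≡ just (wrap W (Q d))) → Walk n mem Q m v v″ k →
    ∃ λ r₄′ → ∃ λ r₅′ → ∃ λ r₆′ → ∃ λ r₇′ →
    Reaches (k * 17 + 3)
      ⟨ 8 , wrap W v ∷ wrap W m ∷ wrap W base ∷ wrap W s ∷ r₄ ∷ r₅ ∷ r₆ ∷ r₇ ∷ f ∷ [] , u₀ ∷ u₁ ∷ u₂ ∷ [] , [] , [] ⟩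
      ⟨ 26 , wrap W v″ ∷ wrap W m ∷ wrap W base ∷ wrap W s ∷ r₄′ ∷ r₅′ ∷ r₆′ ∷ r₇′ ∷ f ∷ [] , u₀ ∷ u₁ ∷ u₂ ∷ [] , [] , [] ⟩
  walk-steps r₄ r₅ r₆ r₇ n< m< letter (arrive at d≤n m≤d) = _ , _ , _ , _ ,
    (loadData-step refl (load at) ▸ jumpIf-step refl (eval-lt-false (≤⇒≯ m≤d) (≤-<-trans d≤n n<) m<) ▸ jump-step refl)
  walk-steps {f = f} {u₀} {u₁} {u₂} r₄ r₅ r₆ r₇ n< m< letter (hop at d<m h walk) =
    let _ , _ , _ , _ , first = hop-steps {f = f} {u₀} {u₁} {u₂} {r₄} {r₅} {r₆} {r₇} at d<m m< (letter d<m) h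
        _ , _ , _ , _ , rest  = walk-steps _ _ _ _ n< m< letter walk
    in _ , _ , _ , _ , (first ▸ rest)

  module Verify (n m x : ℕ) (text Q : ℕ → ℕ) (n< : n < 2 ^ W) (m≤n : m ≤ n) (x<n : x < n)
                (at-text : ∀ {i} → i < n → At mem (5 + i) (text i)) (text< : ∀ i → text i < 2 ^ W) (Q< : ∀ i → Q i < 2 ^ W)
                (letter : ∀ {j} → j < m → read pat j ≡ just (wrap W (Q j))) where

    Matches : Set
    Matches = x + m ≤ n × (∀ {j} → j < m → text (x + j) ≡ Q j)

    m< : m < 2 ^ W
    m< = ≤-<-trans m≤n n<

    -- A matched letter costs seven instructions and the final test one. The failing outcome carries
    -- a mismatch, by which `answer` can exclude it.
    Scan : (rest j : ℕ) (r₀ r₂ r₃ r₅ r₈ : Word W) (us : Vec ℝ 3) → Set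
    Scan rest j r₀ r₂ r₃ r₅ r₈ us =
      ((∀ {i} → j ≤ i → i < m → text (x + i) ≡ Q i) ×
        ∃ λ r₀′ → ∃ λ r₄′ → ∃ λ r₅′ → ∃ λ r₆′ → Reaches (rest * 7 + 1) start
          ⟨ 47 , r₀′ ∷ wrap W m ∷ r₂ ∷ r₃ ∷ r₄′ ∷ r₅′ ∷ r₆′ ∷ wrap W 1 ∷ r₈ ∷ [] , us , [] , [] ⟩)
      ⊎ ((∃ λ i → i < m × text (x + i) ≢ Q i) ×
        ∃ λ t → t ≤ rest * 7 + 1 × ∃ λ rs → Reaches t start ⟨ 57 , rs , us , [] , [] ⟩)
      where
      start = ⟨ 39 , r₀ ∷ wrap W m ∷ r₂ ∷ r₃ ∷ wrap W (5 + x) ∷ r₅ ∷ wrap W j ∷ wrap W 1 ∷ r₈ ∷ [] , us , [] , [] ⟩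

    scan : ∀ rest j r₀ r₂ r₃ r₅ r₈ us → j + rest ≡ m → x + m ≤ n → Scan rest j r₀ r₂ r₃ r₅ r₈ us
    scan zero j r₀ r₂ r₃ r₅ r₈ us j≡m _ = inj₁
      ( (λ j≤i i<m → contradiction (<-≤-trans i<m (≤-trans (≤-reflexive (trans (sym j≡m) (+-identityʳ j))) j≤i)) (<-irrefl refl))
      , _ , _ , _ , _ , jumpIf-step refl (eval-eq-true (trans (sym (+-identityʳ j)) j≡m)))
    scan (suc rest) j r₀ r₂ r₃ r₅ r₈ us j+≡m x+m≤n = go (text (x + j) ≟ Q j)
      where
      j<m : j < m
      j<m = subst (j <_) j+≡m (m<m+n j z<s)
      x+j<n : x + j < n
      x+j<n = <-≤-trans (+-monoʳ-< x j<m) x+m≤n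
      fetch-letters =
          jumpIf-step refl (eval-eq-false (<⇒≢ j<m) (<-trans j<m m<) m<)
        ▸ loadPat-step refl (trans (cong (read pat) (toℕ-wrap (<-trans j<m m<))) (letter j<m))
        ▸ arith-step refl (eval-add (5 + x) j)
        ▸ loadData-step refl (load (at-text x+j<n))
      go : Dec (text (x + j) ≡ Q j) → Scan (suc rest) j r₀ r₂ r₃ r₅ r₈ us
      go (no  ≢) = inj₂ ((j , j<m , ≢) , 6 , ≤-trans (n≤1+n 6) (≤-trans (m≤m+n 7 (rest * 7)) (m≤m+n _ 1)) , _ ,
        (fetch-letters ▸ jumpIf-step refl (eval-eq-false (≢ ∘ sym) (Q< j) (text< (x + j))) ▸ jump-step refl))
      go (yes ≡) with scan rest (suc j) (wrap W (text (x + j))) r₂ r₃ (wrap W (Q j)) r₈ us (trans (sym (+-suc j rest)) j+≡m) x+m≤n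
      ... | inj₁ (rest≡ , _ , _ , _ , _ , reach) = inj₁
        ( (λ {i} j≤i i<m → [ (λ j<i → rest≡ j<i i<m) , (λ { refl → ≡ }) ]′ (m≤n⇒m<n∨m≡n j≤i))
        , _ , _ , _ , _ , (next ▸ reach))
        where
        next = fetch-letters ▸ jumpIf-step refl (eval-eq-true (sym ≡))
          ▸ arith-step refl (trans (eval-add j 1) (cong (just ∘ wrap W) (+-comm j 1))) ▸ jump-step refl
      ... | inj₂ (differ , t , t≤ , rs , reach) = inj₂ (differ , 7 + t , +-monoʳ-≤ 7 t≤ , rs , (next ▸ reach))
        where
        next = fetch-letters ▸ jumpIf-step refl (eval-eq-true (sym ≡))
          ▸ arith-step refl (trans (eval-add j 1) (cong (just ∘ wrap W) (+-comm j 1))) ▸ jump-step refl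

  empty-query : length pat ≡ 0 → queryWithin program (structure W mem) pat 4 ≡ just 0ᴿ
  empty-query pat≡0 = returning steps refl
    where
    steps : Reaches 3 (initial program (structure W mem) pat) ⟨ 57 , _ , 0ᴿ ∷ 0ᴿ ∷ 0ᴿ ∷ [] , [] , [] ⟩
    steps = patLength-step refl ▸ const-step refl ▸ jumpIf-step refl (eval-eq-true pat≡0)

  module Query (n m root₁ root₂ : ℕ) (text Q : ℕ → ℕ) (n< : n < 2 ^ W) (0<m : 0 < m) (m≤n : m ≤ n)
    (at-n : At mem 0 n) (at-root₁ : At mem 1 root₁) (at-root₂ : At mem 2 root₂)
    (at-text : ∀ {i} → i < n → At mem (5 + i) (text i)) (text< : ∀ i → text i < 2 ^ W) (Q< : ∀ i → Q i < 2 ^ W)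
    (pat≡m : length pat ≡ m) (letter : ∀ {j} → j < m → read pat j ≡ just (wrap W (Q j)))
    {v₁ k₁ x : ℕ} {u₁ : ℝ} (walk₁ : Walk n mem Q m root₁ v₁ k₁) (at-x : At mem (v₁ + 4) x) (x<n : x < n)
    (at-u₁ : ∃ λ d → read mem v₁ ≡ just (d , u₁)) where

    open Verify n m x text Q n< m≤n x<n at-text text< Q< letter

    1<2^W : 1 < 2 ^ W
    1<2^W = ≤-trans (m≤m+n 2 6) 8≤2^W

    letter₁ : ∀ {d} → d < m → read pat (toℕ (wrap W (0 + 1 * d))) ≡ just (wrap W (Q d))
    letter₁ {d} d<m = trans (cong (read pat) (trans (cong (toℕ ∘ wrap W) (*-identityˡ d)) (toℕ-wrap (<-trans d<m m<)))) (letter d<m)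

    -- The word `2 ^ W ∸ 1` acts as minus one. Splitting `m` into `m ∸ suc d` and `suc d` units,
    -- each unit combines with one copy of that word to `2 ^ W` and vanishes.
    letter₂ : ∀ {d} → d < m →
              read pat (toℕ (wrap W (m + (2 ^ W ∸ 1) + (0 + (2 ^ W ∸ 1)) * d))) ≡ just (wrap W (Q (m ∸ suc d)))
    letter₂ {d} d<m = trans (cong (read pat) index) (letter (m∸n<m′ d<m))
      where
      open ≡-Reasoning
      m∸n<m′ : d < m → m ∸ suc d < m
      m∸n<m′ d<m = ∸-monoʳ-< {o = 0} z<s d<m
      -1ʷ = 2 ^ W ∸ 1
      index : toℕ (wrap W (m + -1ʷ + -1ʷ * d)) ≡ m ∸ suc d
      index = begin
        toℕ (wrap W (m + -1ʷ + -1ʷ * d))                ≡⟨ cong (λ z → toℕ (wrap W (z + -1ʷ + -1ʷ * d))) (sym (m∸n+n≡m d<m)) ⟩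
        toℕ (wrap W (m ∸ suc d + suc d + -1ʷ + -1ʷ * d)) ≡⟨ cong (toℕ ∘ wrap W) (solve 3 (λ r d k → r :+ (con 1 :+ d) :+ k :+ k :* d := r :+ (con 1 :+ d) :* (k :+ con 1)) refl (m ∸ suc d) d -1ʷ) ⟩
        toℕ (wrap W (m ∸ suc d + suc d * (-1ʷ + 1)))    ≡⟨ cong (λ z → toℕ (wrap W (m ∸ suc d + suc d * z))) (m∸n+n≡m (<⇒≤ 1<2^W)) ⟩
        toℕ (wrap W (m ∸ suc d + suc d * 2 ^ W))        ≡⟨ cong toℕ (wrap-cong ([m+kn]%n≡m%n (m ∸ suc d) (suc d) (2 ^ W))) ⟩
        toℕ (wrap W (m ∸ suc d))                        ≡⟨ toℕ-wrap (<-trans (m∸n<m′ d<m) m<) ⟩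
        m ∸ suc d                                       ∎

    start : Reaches 8 (initial program (structure W mem) pat)
      ⟨ 8 , wrap W root₁ ∷ wrap W m ∷ wrap W 0 ∷ wrap W 1 ∷ wrap W 0 ∷ wrap W 0 ∷ wrap W 1 ∷ wrap W 0 ∷ wrap W 0 ∷ []
      , 0ᴿ ∷ 0ᴿ ∷ 0ᴿ ∷ [] , [] , [] ⟩
    start = subst (λ z → Reaches 8 _ ⟨ 8 , wrap W root₁ ∷ wrap W z ∷ wrap W 0 ∷ wrap W 1 ∷ wrap W 0 ∷ wrap W 0 ∷ wrap W 1 ∷ wrap W 0 ∷ wrap W 0 ∷ []
                                       , 0ᴿ ∷ 0ᴿ ∷ 0ᴿ ∷ [] , [] , [] ⟩) pat≡m
      ( patLength-step refl ▸ const-step refl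
      ▸ jumpIf-step refl (trans (cong (λ z → evalTest W eq (wrap W z) (wrap W 0)) pat≡m)
          (eval-eq-false (m<n⇒n≢0 0<m) m< (<-trans (s≤s z≤n) 1<2^W)))
      ▸ const-step refl ▸ const-step refl ▸ const-step refl ▸ const-step refl
      ▸ loadData-step refl (load at-root₁) )

    verifying : ∀ {r₄ r₅ r₆ r₇} → x + m < 2 ^ W →
      Reaches 9
        ⟨ 26 , wrap W v₁ ∷ wrap W m ∷ wrap W 0 ∷ wrap W 1 ∷ r₄ ∷ r₅ ∷ r₆ ∷ r₇ ∷ wrap W 0 ∷ [] , 0ᴿ ∷ 0ᴿ ∷ 0ᴿ ∷ [] , [] , [] ⟩
        ⟨ 35 , wrap W n ∷ wrap W m ∷ wrap W 0 ∷ wrap W 1 ∷ wrap W x ∷ wrap W (x + m) ∷ wrap W 0 ∷ wrap W 1 ∷ wrap W 0 ∷ []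
        , u₁ ∷ 0ᴿ ∷ 0ᴿ ∷ [] , [] , [] ⟩
    verifying x+m< =
        loadDataᵛ-step refl (loadᵛ (proj₂ at-u₁))
      ▸ const-step refl
      ▸ jumpIf-step refl (eval-eq-false (λ ()) (<-trans (s≤s z≤n) 1<2^W) 1<2^W)
      ▸ const-step refl
      ▸ arith-step refl (eval-add v₁ 4)
      ▸ loadData-step refl (load at-x)
      ▸ arith-step refl (eval-add x m)
      ▸ const-step refl
      ▸ loadData-step refl (load at-n)

    accept : x + m ≤ n → ∀ {r₄ r₅ r₆ r₇ r₈} →
      Reaches 4
        ⟨ 35 , wrap W n ∷ wrap W m ∷ r₅ ∷ r₆ ∷ wrap W x ∷ wrap W (x + m) ∷ r₄ ∷ r₇ ∷ r₈ ∷ [] , u₁ ∷ 0ᴿ ∷ 0ᴿ ∷ [] , [] , [] ⟩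
        ⟨ 39 , wrap W n ∷ wrap W m ∷ r₅ ∷ r₆ ∷ wrap W (5 + x) ∷ wrap W (x + m) ∷ wrap W 0 ∷ r₇ ∷ r₈ ∷ [] , u₁ ∷ 0ᴿ ∷ 0ᴿ ∷ [] , [] , [] ⟩
    accept x+m≤n =
        jumpIf-step refl (eval-lt-false (≤⇒≯ x+m≤n) n< (≤-<-trans x+m≤n n<))
      ▸ const-step refl
      ▸ arith-step refl (eval-add 5 x)
      ▸ const-step refl

    switch : ∀ {r₀ r₂ r₃ r₄ r₅ r₆ r₈} →
      Reaches 8
        ⟨ 47 , r₀ ∷ wrap W m ∷ r₂ ∷ r₃ ∷ r₄ ∷ r₅ ∷ r₆ ∷ wrap W 1 ∷ r₈ ∷ [] , u₁ ∷ 0ᴿ ∷ 0ᴿ ∷ [] , [] , [] ⟩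
        ⟨ 8 , wrap W root₂ ∷ wrap W m ∷ wrap W (m + (2 ^ W ∸ 1)) ∷ wrap W (0 + (2 ^ W ∸ 1)) ∷ r₄ ∷ r₅ ∷ wrap W 2 ∷ wrap W 1 ∷ wrap W 1 ∷ []
        , u₁ ∷ u₁ ∷ 0ᴿ ∷ [] , [] , [] ⟩
    switch =
        moveᵛ-step refl
      ▸ arith-step refl (eval-sub m 1 1<2^W)
      ▸ const-step refl
      ▸ arith-step refl (eval-sub 0 1 1<2^W)
      ▸ const-step refl
      ▸ const-step refl
      ▸ loadData-step refl (trans (cong (read _) (toℕ-wrap (≤-trans (m≤m+n 3 5) 8≤2^W))) (read-map (wrap W ∘ proj₁) mem 2 (proj₂ at-root₂)))
      ▸ jump-step refl

    first-descent = walk-steps {base = 0} {1} {wrap W 0} {0ᴿ} {0ᴿ} {0ᴿ} (wrap W 0) (wrap W 0) (wrap W 1) (wrap W 0) n< m< letter₁ walk₁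

    to-35 : x + m < 2 ^ W → Reaches (8 + (k₁ * 17 + 3 + 9)) (initial program (structure W mem) pat)
      ⟨ 35 , wrap W n ∷ wrap W m ∷ wrap W 0 ∷ wrap W 1 ∷ wrap W x ∷ wrap W (x + m) ∷ wrap W 0 ∷ wrap W 1 ∷ wrap W 0 ∷ []
      , u₁ ∷ 0ᴿ ∷ 0ᴿ ∷ [] , [] , [] ⟩
    to-35 x+m< = start ▸ (proj₂ (proj₂ (proj₂ (proj₂ first-descent))) ▸ verifying x+m<)

    Answers : ℕ → ℝ → Set
    Answers t u = queryWithin program (structure W mem) pat t ≡ just u

    reject : x + m < 2 ^ W → ¬ Matches → Answers (k₁ * 17 + m * 7 + 30) 0ᴿ
    reject x+m< ¬matches with x + m ≤? n
    ... | no x+m≰n = run-mono (≤-trans (≤-reflexive (solve 1 (λ k → con 8 :+ (k :+ con 3 :+ con 9) :+ con 1 :+ con 1 := k :+ con 22) refl (k₁ * 17)))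
                        (+-mono-≤ (m≤m+n (k₁ * 17) (m * 7)) (m≤m+n 22 8)))
          (returning (to-35 x+m< ▸ jumpIf-step refl (eval-lt-true (≰⇒> x+m≰n) x+m<)) refl)
    ... | yes x+m≤n with scan m 0 (wrap W n) (wrap W 0) (wrap W 1) (wrap W (x + m)) (wrap W 0) (u₁ ∷ 0ᴿ ∷ 0ᴿ ∷ []) refl x+m≤n
    ... | inj₁ (all≡ , _) = ⊥-elim (¬matches (x+m≤n , λ j<m → all≡ z≤n j<m))
    ... | inj₂ (_ , t , t≤ , _ , reach) = run-mono
          (≤-trans (+-monoˡ-≤ 1 (+-monoʳ-≤ (8 + (k₁ * 17 + 3 + 9)) (+-monoʳ-≤ 4 t≤)))
            (≤-trans (≤-reflexive (solve 2 (λ k m → con 8 :+ (k :+ con 3 :+ con 9) :+ (con 4 :+ (m :+ con 1)) :+ con 1 := k :+ m :+ con 26) refl (k₁ * 17) (m * 7)))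
              (+-monoʳ-≤ (k₁ * 17 + m * 7) (m≤m+n 26 4))))
          (returning (to-35 x+m< ▸ (accept x+m≤n ▸ reach)) refl)

    answer : x + m < 2 ^ W → Matches → ∀ {v₂ k₂ u₂} → Walk n mem (λ d → Q (m ∸ suc d)) m root₂ v₂ k₂ →
             (∃ λ d → read mem v₂ ≡ just (d , u₂)) → Answers (k₁ * 17 + m * 7 + (k₂ * 17 + 41)) (u₂ +ᴿ (-ᴿ u₁))
    answer x+m< (x+m≤n , ≡s) {k₂ = k₂} walk₂ at-u₂ with scan m 0 (wrap W n) (wrap W 0) (wrap W 1) (wrap W (x + m)) (wrap W 0) (u₁ ∷ 0ᴿ ∷ 0ᴿ ∷ []) refl x+m≤n
    ... | inj₂ ((i , i<m , ≢) , _) = contradiction (≡s i<m) ≢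
    ... | inj₁ (_ , _ , _ , _ , _ , reach) = run-mono
          (≤-reflexive (solve 3 (λ k m l → con 8 :+ (k :+ con 3 :+ con 9) :+ (con 4 :+ (m :+ con 1 :+ (con 8 :+ (l :+ con 3 :+ con 4)))) :+ con 1
            := k :+ m :+ (l :+ con 41)) refl (k₁ * 17) (m * 7) (k₂ * 17)))
          (returning (to-35 x+m< ▸ (accept x+m≤n ▸ (reach ▸ (switch ▸
            (proj₂ (proj₂ (proj₂ (proj₂ (walk-steps _ _ _ _ n< m< letter₂ walk₂)))) ▸ finish))))) refl)
      where
      finish =
          loadDataᵛ-step refl (loadᵛ (proj₂ at-u₂))
        ▸ const-step refl
        ▸ jumpIf-step refl (eval-eq-true refl)
        ▸ subᵛ-step refl

-- Utilities as differences of prefix sums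

module PrefixSums (V : AbelianGroup 0ℓ 0ℓ) where

  open AbelianGroup V using (setoid; commutativeSemigroup; _≈_; _∙_; _⁻¹; ε; ∙-cong; ∙-congˡ; ∙-congʳ; identityˡ; inverseʳ; reflexive)
    renaming (Carrier to Val; refl to ≈-refl; sym to ≈-sym; trans to ≈-trans; assoc to ∙-assoc)
  open AbelianGroupProperties V using (⁻¹-∙-comm; ε⁻¹≈ε; xyx⁻¹≈y)
  open CommutativeSemigroupProperties commutativeSemigroup using (interchange; x∙yz≈y∙xz)
  open Utilities V using () renaming (sumOver to total; globalUtility to utility)
  open SetoidReasoning setoid

  sum-cong : ∀ {A : Set} (xs : List A) {f g : A → Val} → (∀ x → f x ≈ g x) → total xs f ≈ total xs g
  sum-cong []       f≈g = ≈-refl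
  sum-cong (x ∷ xs) f≈g = ∙-cong (f≈g x) (sum-cong xs f≈g)

  sum-difference : ∀ {A : Set} (xs : List A) (f g : A → Val) →
                   total xs (λ x → f x ∙ g x ⁻¹) ≈ total xs f ∙ total xs g ⁻¹
  sum-difference []       f g = ≈-sym (≈-trans (identityˡ _) ε⁻¹≈ε)
  sum-difference (x ∷ xs) f g = begin
    f x ∙ g x ⁻¹ ∙ total xs (λ x → f x ∙ g x ⁻¹)      ≈⟨ ∙-congˡ (sum-difference xs f g) ⟩
    f x ∙ g x ⁻¹ ∙ (total xs f ∙ total xs g ⁻¹)         ≈⟨ interchange (f x) (g x ⁻¹) (total xs f) (total xs g ⁻¹) ⟩
    f x ∙ total xs f ∙ (g x ⁻¹ ∙ total xs g ⁻¹)         ≈⟨ ∙-congˡ (⁻¹-∙-comm (g x) (total xs g)) ⟩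
    f x ∙ total xs f ∙ (g x ∙ total xs g) ⁻¹            ∎

  sum-map : ∀ {A B : Set} (h : A → B) xs (f : B → Val) → total (map h xs) f ≡ total xs (f ∘ h)
  sum-map h []       f = refl
  sum-map h (x ∷ xs) f = cong (f (h x) ∙_) (sum-map h xs f)

  sum-filter-⊎ : ∀ {A : Set} {P Q R : Pred A 0ℓ} (P? : Decidable P) (Q? : Decidable Q) (R? : Decidable R) →
                 (∀ {x} → P x → R x) → (∀ {x} → Q x → R x) → (∀ {x} → R x → P x ⊎ Q x) → (∀ {x} → P x → ¬ Q x) →
                 ∀ xs f → total (filter P? xs) f ∙ total (filter Q? xs) f ≈ total (filter R? xs) f
  sum-filter-⊎ P? Q? R? P⇒R Q⇒R R⇒ P⇒¬Q [] f = identityˡ ε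
  sum-filter-⊎ P? Q? R? P⇒R Q⇒R R⇒ P⇒¬Q (x ∷ xs) f
    with ih ← sum-filter-⊎ P? Q? R? P⇒R Q⇒R R⇒ P⇒¬Q xs f | P? x | Q? x | R? x
  ... | yes p | yes q | _     = contradiction q (P⇒¬Q p)
  ... | yes p | no  _ | yes _ = ≈-trans (∙-assoc _ _ _) (∙-congˡ ih)
  ... | yes p | no  _ | no ¬r = contradiction (P⇒R p) ¬r
  ... | no  _ | yes _ | yes _ = ≈-trans (x∙yz≈y∙xz _ _ _) (∙-congˡ ih)
  ... | no  _ | yes q | no ¬r = contradiction (Q⇒R q) ¬r
  ... | no ¬p | no ¬q | yes r = contradiction (R⇒ r) λ { (inj₁ p) → ¬p p ; (inj₂ q) → ¬q q }
  ... | no  _ | no  _ | no  _ = ih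

  module _ {n : ℕ} (w : Fin n → Val) where

    prefix : ℕ → Val
    prefix k = total (filter (λ j → toℕ j <? k) (allFin n)) w

    -- The positions below `i + m` are those below `i` together with the window, even where the
    -- window is cut off by the end of the text.
    sum-window : ∀ (i : Fin n) m → total (window i m) w ≈ prefix (toℕ i + m) ∙ prefix (toℕ i) ⁻¹
    sum-window i m = begin
      total (window i m) w                                             ≈⟨ ≈-sym (xyx⁻¹≈y (prefix (toℕ i)) _) ⟩
      prefix (toℕ i) ∙ total (window i m) w ∙ prefix (toℕ i) ⁻¹        ≈⟨ ∙-congʳ (sum-filter-⊎ (λ j → toℕ j <? toℕ i) _ (λ j → toℕ j <? toℕ i + m)
          (λ j<i → <-≤-trans j<i (m≤m+n (toℕ i) m)) proj₂ split (λ j<i (i≤j , _) → <⇒≱ j<i i≤j) (allFin n) w) ⟩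
      prefix (toℕ i + m) ∙ prefix (toℕ i) ⁻¹                         ∎
      where
      split : ∀ {j : Fin n} → toℕ j < toℕ i + m → toℕ j < toℕ i ⊎ (toℕ i ≤ toℕ j × toℕ j < toℕ i + m)
      split {j} j< with toℕ j <? toℕ i
      ... | yes j<i = inj₁ j<i
      ... | no  j≮i = inj₂ (≮⇒≥ j≮i , j<)

    utility-prefix : ∀ {σ m} T (P : _) → utility {σ} {n} {m} T w P ≈
                     total (map toℕ (Occ T P)) (λ i → prefix (i + m)) ∙ total (map toℕ (Occ T P)) prefix ⁻¹
    utility-prefix {m = m} T P = begin
      total (Occ T P) (λ i → total (window i m) w)                                 ≈⟨ sum-cong (Occ T P) (λ i → sum-window i m) ⟩
      total (Occ T P) (λ i → prefix (toℕ i + m) ∙ prefix (toℕ i) ⁻¹)             ≈⟨ sum-difference (Occ T P) _ _ ⟩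
      total (Occ T P) (λ i → prefix (toℕ i + m)) ∙ total (Occ T P) (prefix ∘ toℕ) ⁻¹
        ≡⟨ sym (cong₂ (λ a b → a ∙ b ⁻¹) (sum-map toℕ (Occ T P) (λ i → prefix (i + m))) (sum-map toℕ (Occ T P) prefix)) ⟩
      total (map toℕ (Occ T P)) (λ i → prefix (i + m)) ∙ total (map toℕ (Occ T P)) prefix ⁻¹ ∎

    -- The argument `suc (k + i)` is one past the last position `k + i` of the occurrence, the form
    -- in which the tree of the reversed text supplies it.
    utility-ends : ∀ {σ k} T P → total (map toℕ (Occ T P)) (λ i → prefix (suc (k + i))) ∙ total (map toℕ (Occ T P)) prefix ⁻¹ ≈
                   utility {σ} {n} {suc k} T w P
    utility-ends {k = k} T P = ≈-trans
      (∙-congʳ (sum-cong (map toℕ (Occ T P)) λ i → reflexive (cong prefix (trans (cong suc (+-comm k i)) (sym (+-suc i k))))))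
      (≈-sym (utility-prefix T P))

    utility-[] : ∀ {σ} T → utility {σ} {n} {0} T w Vec.[] ≈ ε
    utility-[] T = ≈-trans (utility-prefix T Vec.[]) (≈-trans
      (∙-congʳ (sum-cong (map toℕ (Occ T Vec.[])) λ i → reflexive (cong prefix (+-identityʳ i))))
      (inverseʳ (total (map toℕ (Occ T Vec.[])) prefix)))

-- Filtered ranges of positions

filter-map : ∀ {A B : Set} {P : Pred B 0ℓ} {Q : Pred A 0ℓ} (P? : Decidable P) (Q? : Decidable Q) (f : A → B) →
             (∀ {x} → P (f x) → Q x) → (∀ {x} → Q x → P (f x)) → ∀ xs → filter P? (map f xs) ≡ map f (filter Q? xs)
filter-map P? Q? f P⇒Q Q⇒P [] = refl
filter-map P? Q? f P⇒Q Q⇒P (x ∷ xs) with P? (f x) | Q? x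
... | yes _ | yes _ = cong (f x ∷_) (filter-map P? Q? f P⇒Q Q⇒P xs)
... | yes p | no ¬q = contradiction (P⇒Q p) ¬q
... | no ¬p | yes q = contradiction (Q⇒P q) ¬p
... | no  _ | no  _ = filter-map P? Q? f P⇒Q Q⇒P xs

tabulate-toℕ : ∀ {A : Set} n (f : ℕ → A) → tabulate {n = n} (f ∘ toℕ) ≡ applyUpTo f n
tabulate-toℕ zero    f = refl
tabulate-toℕ (suc n) f = cong (f 0 ∷_) (tabulate-toℕ n (f ∘ suc))

map-toℕ-allFin : ∀ n → map toℕ (allFin n) ≡ upTo n
map-toℕ-allFin n = trans (map-tabulate {n = n} id toℕ) (tabulate-toℕ n id)

applyUpTo-+ : ∀ {A : Set} (f : ℕ → A) a b → applyUpTo f (a + b) ≡ applyUpTo f a ++ applyUpTo (f ∘ (a +_)) b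
applyUpTo-+ f zero    b = refl
applyUpTo-+ f (suc a) b = cong (f 0 ∷_) (applyUpTo-+ (f ∘ suc) a b)

-- Meant for `P` on last positions and `Q` on starting positions: the former avoid the first `k`
-- places, the latter the last `k`, and in between they correspond by a shift.
filter-shift : ∀ {P Q : Pred ℕ 0ℓ} (P? : Decidable P) (Q? : Decidable Q) k r →
               (∀ {e} → e < k → ¬ P e) → (∀ {i} → P (k + i) → Q i) → (∀ {i} → Q i → P (k + i)) →
               (∀ {i} → Q i → i < r) → filter P? (upTo (k + r)) ≡ map (k +_) (filter Q? (upTo (k + r)))
filter-shift P? Q? k r P≥k P⇒Q Q⇒P Q<r = begin
  filter P? (upTo (k + r))                                   ≡⟨ cong (filter P?) (applyUpTo-+ id k r) ⟩
  filter P? (upTo k ++ applyUpTo (k +_) r)                   ≡⟨ filter-++ P? (upTo k) _ ⟩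
  filter P? (upTo k) ++ filter P? (applyUpTo (k +_) r)       ≡⟨ cong (_++ filter P? (applyUpTo (k +_) r)) (filter-none P? (All.tabulate (P≥k ∘ ∈-upTo⁻))) ⟩
  filter P? (applyUpTo (k +_) r)                             ≡⟨ cong (filter P?) (sym (map-applyUpTo id (k +_) r)) ⟩
  filter P? (map (k +_) (upTo r))                            ≡⟨ filter-map P? Q? (k +_) P⇒Q Q⇒P (upTo r) ⟩
  map (k +_) (filter Q? (upTo r))                            ≡⟨ cong (map (k +_)) (sym (begin
    filter Q? (upTo (k + r))                                   ≡⟨ cong (filter Q? ∘ upTo) (+-comm k r) ⟩
    filter Q? (upTo (r + k))                                   ≡⟨ cong (filter Q?) (applyUpTo-+ id r k) ⟩
    filter Q? (upTo r ++ applyUpTo (r +_) k)                   ≡⟨ filter-++ Q? (upTo r) _ ⟩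
    filter Q? (upTo r) ++ filter Q? (applyUpTo (r +_) k)       ≡⟨ cong (filter Q? (upTo r) ++_) (filter-none Q? (All.tabulate beyond)) ⟩
    filter Q? (upTo r) ++ []                                   ≡⟨ ++-identityʳ _ ⟩
    filter Q? (upTo r)                                         ∎)) ⟩
  map (k +_) (filter Q? (upTo (k + r)))                      ∎
  where
  open ≡-Reasoning
  beyond : ∀ {x} → x ∈ applyUpTo (r +_) k → ¬ _
  beyond x∈ q with ∈-applyUpTo⁻ (r +_) x∈
  ... | i , _ , refl = <⇒≱ (Q<r q) (m≤m+n r i)

-- Strings

n<2^n : ∀ n → n < 2 ^ n
n<2^n zero    = s≤s z≤n
n<2^n (suc n) = subst (_≤ 2 ^ suc n) (+-comm (suc n) 1) (+-mono-≤ (n<2^n n) (subst (1 ≤_) (sym (+-identityʳ (2 ^ n))) (m^n>0 2 n)))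

linear≤ : ∀ {a b c} n → a ≤ c → b ≤ c → a * n + b ≤ c * suc n
linear≤ {a} {b} {c} n a≤c b≤c = begin
  a * n + b      ≤⟨ +-mono-≤ (*-monoˡ-≤ n a≤c) b≤c ⟩
  c * n + c      ≡⟨ +-comm (c * n) c ⟩
  c + c * n      ≡⟨ sym (*-suc c n) ⟩
  c * suc n      ∎
  where open ≤-Reasoning

letters : ∀ {σ n} → Vec (Fin σ) n → List ℕ
letters T = map toℕ (toList T)

length-letters : ∀ {σ n} (T : Vec (Fin σ) n) → length (letters T) ≡ n
length-letters T = trans (length-map toℕ (toList T)) (length-toList T)

read-letters : ∀ {σ n} (T : Vec (Fin σ) n) i → read (letters T) (toℕ i) ≡ just (toℕ (lookup T i))
read-letters (a ∷ T) Fin.zero    = refl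
read-letters (a ∷ T) (Fin.suc i) = read-letters T i

-- The default 0 makes the string a total function, as the walks expect, and is a valid word.
letter : ∀ {σ n} → Vec (Fin σ) n → ℕ → ℕ
letter T i = fromMaybe 0 (read (letters T) i)

read-letter : ∀ {σ n} (T : Vec (Fin σ) n) {i} → i < n → read (letters T) i ≡ just (letter T i)
read-letter T {i} i<n = subst (λ j → read (letters T) j ≡ just (letter T j)) (toℕ-fromℕ< i<n)
  (trans (read-letters T (fromℕ< i<n)) (cong (just ∘ fromMaybe 0) (sym (read-letters T (fromℕ< i<n)))))

letter-lookup : ∀ {σ n} (T : Vec (Fin σ) n) i → letter T (toℕ i) ≡ toℕ (lookup T i)
letter-lookup T i = cong (fromMaybe 0) (read-letters T i)

read-letters-< : ∀ {σ n} (T : Vec (Fin σ) n) {i a} → read (letters T) i ≡ just a → i < n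
read-letters-< T {i} eqn = subst (i <_) (length-letters T) (read-< (letters T) eqn)

read-letters-<σ : ∀ {σ n} (T : Vec (Fin σ) n) {i a} → read (letters T) i ≡ just a → a < σ
read-letters-<σ {σ} T {i} {a} eqn = subst (_< σ) (just-injective (trans (sym (read-letters T j)) (trans (cong (read (letters T)) (toℕ-fromℕ< i<n)) eqn))) (toℕ<n (lookup T j))
  where
  i<n = read-letters-< T {i} eqn
  j   = fromℕ< i<n

module Encoding {W σ : ℕ} (σ≤2^W : σ ≤ 2 ^ W) where

  open Words W

  encode-wrap : ∀ (a : Fin σ) → inject≤ a σ≤2^W ≡ wrap W (toℕ a)
  encode-wrap a = toℕ-injective (trans (toℕ-inject≤ a σ≤2^W) (sym (toℕ-wrap (<-≤-trans (toℕ<n a) σ≤2^W))))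

  encode-letters : ∀ {m} (P : Vec (Fin σ) m) → encode W σ≤2^W P ≡ map (wrap W) (letters P)
  encode-letters []      = refl
  encode-letters (a ∷ P) = cong₂ _∷_ (encode-wrap a) (encode-letters P)

  length-encode : ∀ {m} (P : Vec (Fin σ) m) → length (encode W σ≤2^W P) ≡ m
  length-encode P = trans (cong length (encode-letters P)) (trans (length-map (wrap W) (letters P)) (length-letters P))

  read-encode : ∀ {m} (P : Vec (Fin σ) m) {j} → j < m → read (encode W σ≤2^W P) j ≡ just (wrap W (letter P j))
  read-encode P {j} j<m = trans (cong (λ xs → read xs j) (encode-letters P)) (read-map (wrap W) (letters P) j (read-letter P j<m))

  letter< : 0 < 2 ^ W → ∀ {m} (P : Vec (Fin σ) m) j → letter P j < 2 ^ W
  letter< 0< P j = go (read (letters P) j) refl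
    where
    go : ∀ a → read (letters P) j ≡ a → fromMaybe 0 a < 2 ^ W
    go nothing  _  = 0<
    go (just a) eqn = <-≤-trans (read-letters-<σ P {j} eqn) σ≤2^W

module Text {σ n : ℕ} (T : Vec (Fin σ) n) where

  -- `backward e` reads leftwards from position `e`. Without the guard, the truncated subtraction
  -- would repeat the first letter of the text forever.
  forward backward : ℕ → ℕ → Maybe ℕ
  forward i j = read (letters T) (i + j)
  backward e j with j ≤? e
  ... | yes _ = read (letters T) (e ∸ j)
  ... | no  _ = nothing

  backward-≤ : ∀ {e j} → j ≤ e → backward e j ≡ read (letters T) (e ∸ j)
  backward-≤ {e} {j} j≤e with j ≤? e
  ... | yes _   = refl
  ... | no  j≰e = contradiction j≤e j≰e

  backward-≰ : ∀ {e j a} → backward e j ≡ just a → j ≤ e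
  backward-≰ {e} {j} eqn with j ≤? e
  ... | yes j≤e = j≤e

  Occurs : (ℕ → ℕ → Maybe ℕ) → (ℕ → ℕ) → ℕ → ℕ → Set
  Occurs L Q m i = ∀ {j} → j < m → L i j ≡ just (Q j)

  occursAt⇒ : ∀ {m} (P : Vec (Fin σ) m) {i} → OccursAt T P i → Occurs forward (letter P) m (toℕ i)
  occursAt⇒ P {i} occ {j} j<m with occ (fromℕ< j<m)
  ... | k , k≡ , eqn = begin
    read (letters T) (toℕ i + j)                  ≡⟨ cong (read (letters T)) (trans (cong (toℕ i +_) (sym (toℕ-fromℕ< j<m))) (sym k≡)) ⟩
    read (letters T) (toℕ k)                      ≡⟨ read-letters T k ⟩
    just (toℕ (lookup T k))                       ≡⟨ cong (just ∘ toℕ) eqn ⟩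
    just (toℕ (lookup P (fromℕ< j<m)))            ≡⟨ cong just (sym (letter-lookup P (fromℕ< j<m))) ⟩
    just (letter P (toℕ (fromℕ< j<m)))            ≡⟨ cong (just ∘ letter P) (toℕ-fromℕ< j<m) ⟩
    just (letter P j)                             ∎
    where open ≡-Reasoning

  ⇒occursAt : ∀ {m} (P : Vec (Fin σ) m) {i} → Occurs forward (letter P) m (toℕ i) → OccursAt T P i
  ⇒occursAt P {i} occ j = k , toℕ-fromℕ< i+j<n , toℕ-injective (just-injective (begin
    just (toℕ (lookup T k))                       ≡⟨ sym (read-letters T k) ⟩
    read (letters T) (toℕ k)                      ≡⟨ cong (read (letters T)) (toℕ-fromℕ< i+j<n) ⟩
    read (letters T) (toℕ i + toℕ j)              ≡⟨ occ (toℕ<n j) ⟩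
    just (letter P (toℕ j))                       ≡⟨ cong just (letter-lookup P j) ⟩
    just (toℕ (lookup P j))                       ∎))
    where
    open ≡-Reasoning
    i+j<n = read-letters-< T {toℕ i + toℕ j} (occ (toℕ<n j))
    k     = fromℕ< i+j<n

  -- Patterns of length suc k: an occurrence that starts at i ends at k + i.
  module _ (Q : ℕ → ℕ) (k : ℕ) where

    Q⁻ : ℕ → ℕ
    Q⁻ j = Q (k ∸ j)

    backward⇒forward : ∀ {i} → Occurs backward Q⁻ (suc k) (k + i) → Occurs forward Q (suc k) i
    backward⇒forward {i} occ {j} (s≤s j≤k) = begin
      read (letters T) (i + j)                    ≡⟨ cong (read (letters T)) (sym shift) ⟩
      read (letters T) (k + i ∸ (k ∸ j))          ≡⟨ sym (backward-≤ (≤-trans (m∸n≤m k j) (m≤m+n k i))) ⟩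
      backward (k + i) (k ∸ j)                    ≡⟨ occ (s≤s (m∸n≤m k j)) ⟩
      just (Q (k ∸ (k ∸ j)))                      ≡⟨ cong (just ∘ Q) (m∸[m∸n]≡n j≤k) ⟩
      just (Q j)                                  ∎
      where
      open ≡-Reasoning
      shift : k + i ∸ (k ∸ j) ≡ i + j
      shift = trans (cong (_∸ (k ∸ j)) (+-comm k i)) (trans (+-∸-assoc i (m∸n≤m k j)) (cong (i +_) (m∸[m∸n]≡n j≤k)))

    forward⇒backward : ∀ {i} → Occurs forward Q (suc k) i → Occurs backward Q⁻ (suc k) (k + i)
    forward⇒backward {i} occ {j} (s≤s j≤k) = begin
      backward (k + i) j                          ≡⟨ backward-≤ (≤-trans j≤k (m≤m+n k i)) ⟩
      read (letters T) (k + i ∸ j)                ≡⟨ cong (read (letters T)) (trans (cong (_∸ j) (+-comm k i)) (+-∸-assoc i j≤k)) ⟩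
      read (letters T) (i + (k ∸ j))              ≡⟨ occ (s≤s (m∸n≤m k j)) ⟩
      just (Q (k ∸ j))                            ∎
      where open ≡-Reasoning

    backward-≥ : ∀ {e} → e < k → ¬ Occurs backward Q⁻ (suc k) e
    backward-≥ e<k occ = <⇒≱ e<k (backward-≰ (occ ≤-refl))

    forward-< : ∀ {i r} → k + r ≡ n → Occurs forward Q (suc k) i → i < r
    forward-< {i} {r} k+r≡n occ = +-cancelˡ-< k i r (subst₂ _<_ (+-comm i k) (sym k+r≡n) (read-letters-< T {i + k} (occ ≤-refl)))

-- The index

module ℝ⁺ = AbelianGroup ℝ-+-abelianGroup
open PrefixSums ℝ-+-abelianGroup

module Index (c : ℕ) (1000≤c : 1000 ≤ c) (W σ n : ℕ) (σ≤2^W : σ ≤ 2 ^ W) (room : c * suc n ≤ 2 ^ W)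
             (T : Vec (Fin σ) n) (w : Fin n → ℝ) where

  open Words W
  open Encoding {W} {σ} σ≤2^W
  open Text T
  open Memory ℝ 0ᴿ
  open Hashing W

  -- All requirements on the word length, such as `36 * n + 1` for the hash tables and `449 * n + 5`
  -- for the addresses, are instances of this.
  fits : ∀ a b → a ≤ 1000 → b ≤ 1000 → a * n + b ≤ 2 ^ W
  fits a b a≤ b≤ = ≤-trans (linear≤ n (≤-trans a≤ 1000≤c) (≤-trans b≤ 1000≤c)) room

  8≤2^W : 8 ≤ 2 ^ W
  8≤2^W = fits 0 8 z≤n (m≤m+n 8 992)

  0<2^W : 0 < 2 ^ W
  0<2^W = ≤-trans (s≤s z≤n) 8≤2^W

  0<W : 0 < W
  0<W = n≢0⇒n>0 λ W≡0 → <⇒≱ {1} {8} (s≤s (s≤s z≤n)) (subst (λ v → 8 ≤ 2 ^ v) W≡0 8≤2^W)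

  n< : n < 2 ^ W
  n< = subst (_≤ 2 ^ W) (trans (+-comm (1 * n) 1) (cong suc (*-identityˡ n))) (fits 1 1 (m≤m+n 1 999) (m≤m+n 1 999))

  n+n≤ : n + n ≤ 2 ^ W
  n+n≤ = subst (_≤ 2 ^ W) (solve 1 (λ n → con 2 :* n :+ con 0 := n :+ n) refl n) (fits 2 0 (m≤m+n 2 998) z≤n)

  1+36*n≤ : 1 + 36 * n ≤ 2 ^ W
  1+36*n≤ = subst (_≤ 2 ^ W) (+-comm (36 * n) 1) (fits 36 1 (m≤m+n 36 964) (m≤m+n 1 999))

  forward< : ∀ {i j a} → forward i j ≡ just a → a < 2 ^ W
  forward< {i} {j} e = <-≤-trans (read-letters-<σ T {i + j} e) σ≤2^W

  backward< : ∀ {i j a} → backward i j ≡ just a → a < 2 ^ W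
  backward< {i} {j} e = <-≤-trans (read-letters-<σ T {i ∸ j} (trans (sym (backward-≤ {i} {j} (backward-≰ {i} {j} e))) e)) σ≤2^W

  -- The items of the second tree are last positions, and the prefix sum wanted there includes the
  -- last position itself, hence `suc`.
  total₁ total₂ : List ℕ → ℝ
  total₁ S = sumOver S (prefix w)
  total₂ S = sumOver S (prefix w ∘ suc)

  module Starts = Trie ℝ 0ᴿ W n forward  total₁ 0<W 1+36*n≤ (λ {i} {j} → forward< {i} {j})
  module Ends   = Trie ℝ 0ᴿ W n backward total₂ 0<W 1+36*n≤ (λ {i} {j} → backward< {i} {j})

  Answered : DataStructure W → Set
  Answered D = ∀ (m : ℕ) (P : Vec (Fin σ) m) → m ≤ n →
    Σ[ u ∈ ℝ ] (queryWithin program D (encode W σ≤2^W P) (c * suc m) ≡ just u × u ≈ᴿ globalUtility T w P)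

  Indexed : Set
  Indexed = Σ[ D ∈ DataStructure W ] (DataStructure.size D ≤ c * suc n × Answered D)

  answer-[] : ∀ mem → length mem ≤ 2 ^ W →
    Σ[ u ∈ ℝ ] (queryWithin program (structure W mem) (encode W σ≤2^W []) (c * 1) ≡ just u × u ≈ᴿ globalUtility T w [])
  answer-[] mem mem≤ = 0ᴿ ,
    run-mono (≤-trans (m≤m+n 4 996) (≤-trans 1000≤c (≤-reflexive (sym (*-identityʳ c))))) (empty-query refl) ,
    ℝ⁺.sym {globalUtility T w []} {0ᴿ} (utility-[] w T)
    where
    open Simulation W mem mem≤ (n<2^n W) 8≤2^W []
    open Run program (structure W mem) []

  space : ℕ
  space = 112 * (2 * length (upTo n) ∸ 1)

  -- Address 0 doubles as the dummy leaf: its depth is n, and the words at 1, 2 and 3,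
  -- which a walk reads only at inner nodes, may hold anything.
  module Layout (ys₁ ys₂ : List Cell) (root₁ root₂ : ℕ)
    (ys₁≤ : length ys₁ ≤ space) (ys₂≤ : length ys₂ ≤ space)
    (tree₁ : ∀ {mem} → Segment mem (5 + n) ys₁ → Starts.Tree (upTo n) 0 mem root₁)
    (tree₂ : ∀ {mem} → Segment mem (5 + n + length ys₁) ys₂ → Ends.Tree (upTo n) 0 mem root₂) where

    header textCells mem : List Cell
    header    = nodeCells n root₁ root₂ 0 0 0ᴿ
    textCells = map (λ a → a , 0ᴿ) (letters T)
    mem       = header ++ (textCells ++ (ys₁ ++ ys₂))

    length-textCells : length textCells ≡ n
    length-textCells = trans (length-map _ (letters T)) (length-letters T)

    length-mem : length mem ≤ 449 * n + 5
    length-mem = begin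
      length mem                                         ≡⟨ cong (5 +_) (trans (length-++ textCells) (cong₂ _+_ length-textCells (length-++ ys₁))) ⟩
      5 + (n + (length ys₁ + length ys₂))                ≤⟨ +-monoʳ-≤ 5 (+-monoʳ-≤ n (+-mono-≤ (≤-trans ys₁≤ space≤) (≤-trans ys₂≤ space≤))) ⟩
      5 + (n + (224 * n + 224 * n))                      ≡⟨ solve 1 (λ n → con 5 :+ (n :+ (con 224 :* n :+ con 224 :* n)) := con 449 :* n :+ con 5) refl n ⟩
      449 * n + 5                                        ∎
      where
      open ≤-Reasoning
      space≤ : space ≤ 224 * n
      space≤ = begin
        112 * (2 * length (upTo n) ∸ 1)     ≤⟨ *-monoʳ-≤ 112 (m∸n≤m (2 * length (upTo n)) 1) ⟩
        112 * (2 * length (upTo n))         ≡⟨ cong (λ l → 112 * (2 * l)) (length-upTo n) ⟩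
        112 * (2 * n)                       ≡⟨ sym (*-assoc 112 2 n) ⟩
        224 * n                             ∎

    mem≤ : length mem ≤ 2 ^ W
    mem≤ = ≤-trans length-mem (fits 449 5 (m≤m+n 449 551) (m≤m+n 5 995))

    size≤ : DataStructure.size (structure W mem) ≤ c * suc n
    size≤ = begin
      length (map (wrap W ∘ proj₁) mem) + length (map proj₂ mem) + 0 + 0
        ≡⟨ trans (+-identityʳ _) (trans (+-identityʳ _) (cong₂ _+_ (length-map _ mem) (length-map _ mem))) ⟩
      length mem + length mem                  ≤⟨ +-mono-≤ length-mem length-mem ⟩
      (449 * n + 5) + (449 * n + 5)            ≡⟨ solve 1 (λ n → (con 449 :* n :+ con 5) :+ (con 449 :* n :+ con 5) := con 898 :* n :+ con 10) refl n ⟩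
      898 * n + 10                             ≤⟨ linear≤ n (≤-trans (m≤m+n 898 102) 1000≤c) (≤-trans (m≤m+n 10 990) 1000≤c) ⟩
      c * suc n                                ∎
      where open ≤-Reasoning

    seg : Segment mem 0 mem
    seg = segment λ i e → e

    seg-text : Segment mem 5 (textCells ++ (ys₁ ++ ys₂))
    seg-text = segment-++ʳ header seg

    seg-trees : Segment mem (5 + n) (ys₁ ++ ys₂)
    seg-trees = subst (λ l → Segment mem (5 + l) (ys₁ ++ ys₂)) length-textCells (segment-++ʳ textCells seg-text)

    at-text : ∀ {i} → i < n → At mem (5 + i) (letter T i)
    at-text {i} i<n = 0ᴿ , Segment.cell (segment-++ˡ textCells seg-text) i
      (read-map (λ a → a , 0ᴿ) (letters T) i (read-letter T i<n))

    dummy₁ : Starts.DummyLeaf mem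
    dummy₁ = (0ᴿ , refl) , (0ᴿ , refl)

    dummy₂ : Ends.DummyLeaf mem
    dummy₂ = (0ᴿ , refl) , (0ᴿ , refl)

    module Answer (k : ℕ) (P : Vec (Fin σ) (suc k)) (m≤n : suc k ≤ n) where

      m : ℕ
      m = suc k

      Q : ℕ → ℕ
      Q = letter P

      located₁ = tree₁ (segment-++ˡ ys₁ seg-trees) dummy₁ Q m m≤n
      located₂ = tree₂ (segment-++ʳ ys₁ seg-trees) dummy₂ (Q⁻ Q k) m m≤n

      module L₁ = Starts.Located located₁
      module L₂ = Ends.Located located₂

      open Simulation W mem mem≤ (n<2^n W) 8≤2^W (encode W σ≤2^W P)
      open Query n m root₁ root₂ (letter T) Q n< (s≤s z≤n) m≤n (0ᴿ , refl) (0ᴿ , refl) (0ᴿ , refl) at-text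
        (letter< 0<2^W T) (letter< 0<2^W P) (length-encode P) (read-encode P) L₁.walk L₁.at-item L₁.item<n L₁.at-value
      open Verify n m L₁.item (letter T) Q n< m≤n L₁.item<n at-text (letter< 0<2^W T) (letter< 0<2^W P) (read-encode P) using (Matches)
      open Run program (structure W mem) (encode W σ≤2^W P) using (run-mono)

      -- The machine adds before it compares the end of the candidate with `n`, so this sum must not
      -- wrap around.
      item+m< : L₁.item + m < 2 ^ W
      item+m< = <-≤-trans (+-mono-<-≤ L₁.item<n m≤n) n+n≤

      occurrences : map toℕ (Occ T P) ≡ filter (Starts.match? Q m) (upTo n)
      occurrences = trans (sym (filter-map (Starts.match? Q m) (occursAt? T P) toℕ (⇒occursAt P) (occursAt⇒ P) (allFin n)))
        (cong (filter (Starts.match? Q m)) (map-toℕ-allFin n))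

      ends : filter (Ends.match? (Q⁻ Q k) m) (upTo n) ≡ map (k +_) (filter (Starts.match? Q m) (upTo n))
      ends = subst (λ n′ → filter (Ends.match? (Q⁻ Q k) m) (upTo n′) ≡ map (k +_) (filter (Starts.match? Q m) (upTo n′))) k+r≡n
        (filter-shift (Ends.match? (Q⁻ Q k) m) (Starts.match? Q m) k (n ∸ k)
          (backward-≥ Q k) (backward⇒forward Q k) (forward⇒backward Q k) (forward-< Q k k+r≡n))
        where
        k+r≡n : k + (n ∸ k) ≡ n
        k+r≡n = m+[n∸m]≡n (<⇒≤ m≤n)

      matches⇒ : Matches → Starts.Match Q m L₁.item
      matches⇒ (x+m≤n , ≡s) {j} j<m = trans (read-letter T (<-≤-trans (+-monoʳ-< L₁.item j<m) x+m≤n)) (cong just (≡s j<m))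

      ⇒matches : Starts.Match Q m L₁.item → Matches
      ⇒matches match = subst (_≤ n) (sym (+-suc L₁.item k)) (read-letters-< T {L₁.item + k} (match ≤-refl)) ,
        λ {j} j<m → just-injective (trans (sym (read-letter T (read-letters-< T {L₁.item + j} (match j<m)))) (match j<m))

      time≤ : ∀ {t} → t ≤ 75 * m + 41 → t ≤ c * suc m
      time≤ t≤ = ≤-trans t≤ (linear≤ m (≤-trans (m≤m+n 75 925) 1000≤c) (≤-trans (m≤m+n 41 959) 1000≤c))

      u₁≡ : Starts.Match Q m L₁.item → L₁.value ≡ sumOver (map toℕ (Occ T P)) (prefix w)
      u₁≡ match = trans (proj₂ (L₁.correct (∈-upTo⁺ L₁.item<n) match)) (cong total₁ (sym occurrences))

      -- The verified occurrence ends at `k + L₁.item`, which is thus a matching item of the second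
      -- tree and validates the second descent without a comparison of its own.
      u₂≡ : Starts.Match Q m L₁.item → L₂.value ≡ sumOver (map toℕ (Occ T P)) (λ i → prefix w (suc (k + i)))
      u₂≡ match = begin
        L₂.value                                                                     ≡⟨ proj₂ (L₂.correct (∈-upTo⁺ k+x<n) (forward⇒backward Q k match)) ⟩
        total₂ (filter (Ends.match? (Q⁻ Q k) m) (upTo n))                            ≡⟨ cong total₂ (trans ends (cong (map (k +_)) (sym occurrences))) ⟩
        total₂ (map (k +_) (map toℕ (Occ T P)))                                      ≡⟨ sum-map (k +_) (map toℕ (Occ T P)) (prefix w ∘ suc) ⟩
        sumOver (map toℕ (Occ T P)) (λ i → prefix w (suc (k + i)))                   ∎
        where
        open ≡-Reasoning
        k+x<n : k + L₁.item < n
        k+x<n = subst (_< n) (+-comm L₁.item k) (read-letters-< T {L₁.item + k} (match ≤-refl))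

      -- A single item decides. If it matches, it is the witness that both descents need; if not,
      -- `L₁.correct` shows by contraposition that no position matches, so the utility is an empty
      -- sum.
      answers : Σ[ u ∈ ℝ ] (queryWithin program (structure W mem) (encode W σ≤2^W P) (c * suc m) ≡ just u × u ≈ᴿ globalUtility T w P)
      answers with Starts.match? Q m L₁.item
      ... | yes match = L₂.value +ᴿ (-ᴿ L₁.value) ,
              run-mono (time≤ bound) (answer item+m< (⇒matches match) L₂.walk L₂.at-value) ,
              subst₂ (λ u₁ u₂ → u₂ +ᴿ (-ᴿ u₁) ≈ᴿ globalUtility T w P) (sym (u₁≡ match)) (sym (u₂≡ match)) (utility-ends w T P)
        where
        -- Per letter, each descent makes at most two hops of 17 instructions and the comparison
        -- takes 7, which gives 34 + 7 + 34 = 75.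
        bound : L₁.steps * 17 + m * 7 + (L₂.steps * 17 + 41) ≤ 75 * m + 41
        bound = ≤-trans (+-mono-≤ (+-monoˡ-≤ (m * 7) (*-monoˡ-≤ 17 L₁.steps≤)) (+-monoˡ-≤ 41 (*-monoˡ-≤ 17 L₂.steps≤)))
          (≤-reflexive (solve 1 (λ m → con 2 :* m :* con 17 :+ m :* con 7 :+ (con 2 :* m :* con 17 :+ con 41) := con 75 :* m :+ con 41) refl m))
      ... | no ¬match = 0ᴿ ,
              run-mono (time≤ bound) (reject item+m< (¬match ∘ matches⇒)) ,
              ℝ⁺.reflexive (cong (λ is → sumOver is (λ i → sumOver (window i m) w)) (sym (map-[] (Occ T P) (trans occurrences none))))
        where
        bound : L₁.steps * 17 + m * 7 + 30 ≤ 75 * m + 41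
        bound = ≤-trans (+-mono-≤ (+-monoˡ-≤ (m * 7) (*-monoˡ-≤ 17 L₁.steps≤)) (m≤m+n 30 11))
          (≤-trans (≤-reflexive (solve 1 (λ m → con 2 :* m :* con 17 :+ m :* con 7 :+ con 41 := con 41 :* m :+ con 41) refl m))
            (+-monoˡ-≤ 41 (*-monoˡ-≤ m (m≤m+n 41 34))))
        none : filter (Starts.match? Q m) (upTo n) ≡ []
        none = filter-none (Starts.match? Q m) (All.tabulate λ i∈ match → ¬match (proj₁ (L₁.correct i∈ match)))
        map-[] : ∀ (is : List (Fin n)) → map toℕ is ≡ [] → is ≡ []
        map-[] [] _ = refl

    indexed : Indexed
    indexed = structure W mem , size≤ , λ
      { zero    []  _   → answer-[] mem mem≤
      ; (suc k) P   m≤n → Answer.answers k P m≤n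
      }

  index : Indexed
  index with n ≟ 0
  -- A tree needs at least one item. For the empty text only the empty pattern can be queried, and
  -- it reads no data.
  ... | yes n≡0 = structure W [] , z≤n , λ
      { zero    [] _   → answer-[] [] z≤n
      ; (suc k) P  m≤n → contradiction (subst (suc k ≤_) n≡0 m≤n) λ ()
      }
  ... | no n≢0 = from-trees (Starts.allocate-tree n (upTo n) 0 0<items items≤n ≤-refl items< z≤n (λ _ _ ()) (5 + n))
    where
    0<n : 0 < n
    0<n = n≢0⇒n>0 n≢0
    0<items : 0 < length (upTo n)
    0<items = subst (0 <_) (sym (length-upTo n)) 0<n
    items≤n : length (upTo n) ≤ n
    items≤n = ≤-reflexive (length-upTo n)
    items< : All (_< n) (upTo n)
    items< = All.tabulate ∈-upTo⁻
    from-trees : (∃ λ ys → ∃ λ v → length ys ≤ space × (∀ {mem} → Segment mem (5 + n) ys → Starts.Tree (upTo n) 0 mem v)) → Indexed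
    from-trees (ys₁ , root₁ , ys₁≤ , tree₁) =
      from-tree₂ (Ends.allocate-tree n (upTo n) 0 0<items items≤n ≤-refl items< z≤n (λ _ _ ()) (5 + n + length ys₁))
      where
      from-tree₂ : (∃ λ ys → ∃ λ v → length ys ≤ space × (∀ {mem} → Segment mem (5 + n + length ys₁) ys → Ends.Tree (upTo n) 0 mem v)) → Indexed
      from-tree₂ (ys₂ , root₂ , ys₂≤ , tree₂) = Layout.indexed ys₁ ys₂ root₁ root₂ ys₁≤ ys₂≤ tree₁ tree₂

theorem4p3 : Σ[ prog ∈ Program ] Σ[ c ∈ ℕ ]
    (∀ (W σ n : ℕ) (σ≤2^W : σ ≤ 2 ^ W) → c * suc n ≤ 2 ^ W →
    ∀ (T : Vec (Fin σ) n) (w : Fin n → ℝ) →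
    Σ[ D ∈ DataStructure W ]
    (DataStructure.size D ≤ c * suc n ×
    (∀ (m : ℕ) (P : Vec (Fin σ) m) → m ≤ n →
    Σ[ u ∈ ℝ ]
    (queryWithin prog D (encode W σ≤2^W P) (c * suc m) ≡ just u ×
    u ≈ᴿ globalUtility T w P))))
theorem4p3 = program , 1000 , λ W σ n σ≤2^W room T w → Index.index 1000 ≤-refl W σ n σ≤2^W room T w
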